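{- For each integer $n\ge 64$ there is a unit rectangle visibility graph on $n$ vertices with at least $6n-12\lfloor\sqrt{n}\,\rfloor+6$ edges.
   Context: A finite simple graph $G$ is a unit rectangle visibility graph (URVG) if its vertices $v$ can be represented by closed unit squares $S_v$ in the plane with sides parallel to the coordinate axes and with pairwise disjoint interiors (squares may touch along their boundaries), in such a way that two distinct vertices $v,w$ are adjacent if and only if there is an unobstructed non-degenerate (positive width) horizontal or vertical band of visibility joining $S_v$ and $S_w$. Here a horizontal band of visibility joining $S_v$ and $S_w$ is given by an open interval $I$ of positive length such that for every $y_0\in I$ the line $y=y_0$ meets the interiors of both $S_v$ and $S_w$, and the part of this line between $S_v$ and $S_w$ (possibly a single point if the squares touch) meets the interior of no other square of the representation; vertical bands are defined analogously with the roles of $x$ and $y$ exchanged. -}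

module Defs where

open import Level using (0ℓ)
open import Data.Fin using (Fin)
import Data.Fin.Properties as Fin
open import Data.List using (List; length; filter; cartesianProduct; allFin)
open import Data.Nat as ℕ using (ℕ; zero; suc)
import Data.Nat.Properties as ℕ
open import Data.Product using (∃; ∃-syntax; _×_; _,_)
open import Data.Rational using (ℚ; 1ℚ; _+_; -_; _-_) renaming (_<_ to _<ℚ_)
import Data.Rational.Properties as ℚ
open import Data.Sum using (_⊎_)
open import Function.Bundles using (_⇔_; mk⇔; Equivalence)
open import Relation.Binary.Core using (Rel)
open import Relation.Binary.Definitions using (Decidable; Irreflexive; Symmetric)
open import Relation.Binary.PropositionalEquality
  using (_≡_; _≢_; sym; trans; cong; subst)
open import Relation.Nullary using (¬_; yes; no)
open import Relation.Nullary.Decidable using (_×-dec_)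
open import Relation.Unary using (Pred)

-- Real numbers as two-sided, located Dedekind cuts of ℚ.

record ℝ : Set₁ where
  field
    lower           : Pred ℚ 0ℓ
    upper           : Pred ℚ 0ℓ
    lower-inhabited : ∃ lower
    upper-inhabited : ∃ upper
    lower-rounded   : ∀ q → lower q ⇔ (∃[ r ] q <ℚ r × lower r)
    upper-rounded   : ∀ q → upper q ⇔ (∃[ r ] r <ℚ q × upper r)
    disjoint        : ∀ q → ¬ (lower q × upper q)
    located         : ∀ {q r} → q <ℚ r → lower q ⊎ upper r

open ℝ

infix 4 _<_ _≤_

_<_ : ℝ → ℝ → Set
x < y = ∃[ q ] upper x q × lower y q

_≤_ : ℝ → ℝ → Set
x ≤ y = ¬ (y < x)

private
  +-cancelʳ : ∀ q s → (q + s) - s ≡ q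
  +-cancelʳ q s = trans (ℚ.+-assoc q s (- s))
    (trans (cong (q +_) (ℚ.+-inverseʳ s)) (ℚ.+-identityʳ q))

  -‿cancelʳ : ∀ q s → (q - s) + s ≡ q
  -‿cancelʳ q s = trans (ℚ.+-assoc q (- s) s)
    (trans (cong (q +_) (ℚ.+-inverseˡ s)) (ℚ.+-identityʳ q))

  shift-inhabited : ∀ (P : Pred ℚ 0ℓ) s → ∃ P → ∃[ q ] P (q - s)
  shift-inhabited P s (q , Pq) = q + s , subst P (sym (+-cancelʳ q s)) Pq

-- The real number x + s, for rational s: q < x + s iff q - s < x.
infixl 6 _+ʳ_

_+ʳ_ : ℝ → ℚ → ℝ
x +ʳ s = record
  { lower           = λ q → lower x (q - s)
  ; upper           = λ q → upper x (q - s)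
  ; lower-inhabited = shift-inhabited (lower x) s (lower-inhabited x)
  ; upper-inhabited = shift-inhabited (upper x) s (upper-inhabited x)
  ; lower-rounded   = λ q → mk⇔
      (λ l → let r , q-s<r , lr = Equivalence.to (lower-rounded x (q - s)) l in
        r + s
        , subst (_<ℚ (r + s)) (-‿cancelʳ q s) (ℚ.+-monoˡ-< s q-s<r)
        , subst (lower x) (sym (+-cancelʳ r s)) lr)
      (λ (r , q<r , lr) → Equivalence.from (lower-rounded x (q - s))
        (r - s , ℚ.+-monoˡ-< (- s) q<r , lr))
  ; upper-rounded   = λ q → mk⇔
      (λ u → let r , r<q-s , ur = Equivalence.to (upper-rounded x (q - s)) u in
        r + s
        , subst ((r + s) <ℚ_) (-‿cancelʳ q s) (ℚ.+-monoˡ-< s r<q-s)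
        , subst (upper x) (sym (+-cancelʳ r s)) ur)
      (λ (r , r<q , ur) → Equivalence.from (upper-rounded x (q - s))
        (r - s , ℚ.+-monoˡ-< (- s) r<q , ur))
  ; disjoint        = λ q → disjoint x (q - s)
  ; located         = λ q<r → located x (ℚ.+-monoˡ-< (- s) q<r)
  }

record SimpleGraph (n : ℕ) : Set₁ where
  field
    Adj        : Rel (Fin n) 0ℓ
    adj?       : Decidable Adj
    Adj-sym    : Symmetric Adj
    Adj-irrefl : Irreflexive _≡_ Adj

-- Each edge is listed once, as the pair of its endpoints in increasing order.
edges : ∀ {n} → SimpleGraph n → List (Fin n × Fin n)
edges {n} G = filter (λ (v , w) → (v Fin.<? w) ×-dec adj? v w)
                     (cartesianProduct (allFin n) (allFin n))
  where open SimpleGraph G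

∣E_∣ : ∀ {n} → SimpleGraph n → ℕ
∣E G ∣ = length (edges G)

-- The closed unit square [left , left + 1] × [bottom , bottom + 1].
record Square : Set₁ where
  constructor square
  field
    left bottom : ℝ

  right top : ℝ
  right = left +ʳ 1ℚ
  top   = bottom +ʳ 1ℚ

open Square

Interior : Square → ℝ → ℝ → Set
Interior S x y = (left S < x × x < right S) × (bottom S < y × y < top S)

InteriorsDisjoint : Square → Square → Set₁
InteriorsDisjoint S T = ∀ x y → ¬ (Interior S x y × Interior T x y)

transpose : Square → Square
transpose (square l b) = square b l

-- On a horizontal line meeting the interiors of both S and T, the point with
-- abscissa x lies on the closed segment of the line between S and T.  Squares
-- with disjoint interiors met by one line lie side by side along it, so only
-- one of the two orders can occur.
Between : Square → Square → ℝ → Set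
Between S T x = (right S ≤ x × x ≤ left T) ⊎ (right T ≤ x × x ≤ left S)

module _ {n : ℕ} (S : Fin n → Square) where

  UnobstructedAt : Fin n → Fin n → ℝ → Set₁
  UnobstructedAt v w y =
      (∃[ x ] Interior (S v) x y)
    × (∃[ x ] Interior (S w) x y)
    × (∀ u → u ≢ v → u ≢ w →
         ¬ (∃[ x ] Between (S v) (S w) x × Interior (S u) x y))

  -- The band is given by the open interval (a , b).
  HorizontalBand : Fin n → Fin n → Set₁
  HorizontalBand v w =
    ∃[ a ] ∃[ b ] a < b × (∀ y → a < y → y < b → UnobstructedAt v w y)

VerticalBand : ∀ {n} → (Fin n → Square) → Fin n → Fin n → Set₁
VerticalBand S = HorizontalBand (λ v → transpose (S v))

record IsURVG {n : ℕ} (G : SimpleGraph n) : Set₁ where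
  open SimpleGraph G using (Adj)
  field
    squares  : Fin n → Square
    disjoint : ∀ v w → v ≢ w → InteriorsDisjoint (squares v) (squares w)
    adj⇔band : ∀ v w → v ≢ w →
      Adj v w ⇔ (HorizontalBand squares v w ⊎ VerticalBand squares v w)

⌊√_⌋ : ℕ → ℕ
⌊√ zero ⌋  = 0
⌊√ suc n ⌋ with suc ⌊√ n ⌋ ℕ.* suc ⌊√ n ⌋ ℕ.≤? suc n
... | yes _ = suc ⌊√ n ⌋
... | no  _ = ⌊√ n ⌋

⌊√⌋-spec : ∀ n → ⌊√ n ⌋ ℕ.* ⌊√ n ⌋ ℕ.≤ n × n ℕ.< suc ⌊√ n ⌋ ℕ.* suc ⌊√ n ⌋
⌊√⌋-spec zero = ℕ.z≤n , ℕ.s≤s ℕ.z≤n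
⌊√⌋-spec (suc n) with ⌊√⌋-spec n | suc ⌊√ n ⌋ ℕ.* suc ⌊√ n ⌋ ℕ.≤? suc n
... | lo , hi | no ≰ = ℕ.m≤n⇒m≤1+n lo , ℕ.≰⇒> ≰
... | lo , hi | yes ≤ = ≤ , ℕ.≤-<-trans hi (ℕ.*-mono-< s<1+s s<1+s)
  where s<1+s = ℕ.n<1+n (suc ⌊√ n ⌋)

{-# OPTIONS --safe #-}

-- Squares of side 4 are put at points of the lattice spanned by (5, -2) and
-- (2, 5), the cell (x , y) standing for the point x(5, -2) + y(2, 5), and
-- everything is scaled by 1/4.  In the full lattice every square then sees three
-- others on its right, at the differences (1, 0), (1, 1), (2, 1) of cells, and,
-- after a quarter turn, three others above it, at (0, 1), (-1, 1), (-1, 2).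
-- Removing squares never destroys such a line of sight, so a k × k grid has at
-- least 6(k - 1)² edges, which is the bound for n = k².  For k ≥ 8 the remaining n - k² ≤ 2k ≤ 4(k - 4) squares
-- fit into four strips of at most k - 4 cells, one along each side of the grid,
-- where each new square sees six earlier ones: five in the grid, and the
-- previous one of its strip.  The first square of a strip sees one more grid
-- square instead, since the cell that would hide it stays empty.

module Submission where

open import Defs using (SimpleGraph; IsURVG; ∣E_∣; ⌊√_⌋)
open import Data.Nat using (ℕ; _+_; _*_; _∸_; _≤_)
open import Data.Product using (Σ-syntax; _×_)

open import Data.Empty using (⊥; ⊥-elim)
open import Data.Fin as Fin using (Fin; zero; suc; toℕ; fromℕ<)
import Data.Fin.Properties as Fin
open import Data.Integer as ℤ using (ℤ; +_; 1ℤ)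
import Data.Integer.Properties as ℤ
open import Data.Integer.Tactic.RingSolver using (solve-∀)
open import Data.List
  using (List; []; _∷_; [_]; _++_; length; lookup; map; upTo; applyUpTo; applyDownFrom; cartesianProduct; concatMap)
import Data.List.Membership.DecPropositional as DecMembership
open import Data.List.Membership.Propositional using (_∈_; _∉_; find)
open import Data.List.Membership.Propositional.Properties
open import Data.List.Properties using (length-++; length-map; length-applyUpTo; length-applyDownFrom; length-upTo)
open import Data.List.Relation.Unary.All as All using (All; []; _∷_; tabulate)
import Data.List.Relation.Unary.All.Properties as All
open import Data.List.Relation.Unary.AllPairs as AllPairs using (AllPairs; []; _∷_; allPairs?)
import Data.List.Relation.Unary.AllPairs.Properties as AllPairs
open import Data.List.Relation.Unary.Any using (here; there; index)
open import Data.List.Relation.Unary.Any.Properties using (lookup-index)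
open import Data.List.Relation.Unary.Unique.Propositional using (Unique)
import Data.List.Relation.Unary.Unique.Propositional.Properties as Unique
open import Data.Nat as ℕ using (zero; suc; _⊓_)
open import Data.Nat.Divisibility using (_∣_; _∣?_; ∣n⇒∣m*n; ∣-refl)
open import Data.Nat.ListAction using (sum)
import Data.Nat.Properties as ℕ
open import Data.Nat.Tactic.RingSolver using () renaming (solve-∀ to ℕ-solve-∀)
open import Data.Product using (∃-syntax; _,_; proj₁; proj₂; swap)
open import Data.Product.Properties using (≡-dec)
open import Data.Rational as ℚ using (ℚ; 1ℚ) renaming (_<_ to _<ℚ_; _≤_ to _≤ℚ_)
import Data.Rational.Properties as ℚ
import Data.Rational.Unnormalised as ℚᵘ
import Data.Rational.Unnormalised.Properties as ℚᵘ
open import Data.Sum as Sum using (_⊎_; inj₁; inj₂)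
open import Defs using (ℝ; _+ʳ_; Square; square; Interior; InteriorsDisjoint; HorizontalBand; edges; ⌊√⌋-spec)
  renaming (_<_ to _<ᴿ_; _≤_ to _≤ᴿ_)
open import Function.Base using (_∘_)
open import Function.Bundles using (_⇔_; mk⇔; Equivalence)
open import Relation.Binary.Definitions using (DecidableEquality; Tri; tri<; tri≈; tri>)
open import Relation.Binary.PropositionalEquality
  using (_≡_; _≢_; refl; sym; trans; cong; cong₂; subst; subst₂; module ≡-Reasoning)
open import Relation.Nullary using (¬_; Dec; yes; no; contradiction)
open import Relation.Nullary.Decidable using (_×-dec_; _⊎-dec_; _→-dec_; ¬?; True; toWitness)

open ℝ
open Square using (left; right)
open DecMembership (≡-dec ℤ._≟_ ℤ._≟_) using () renaming (_∈?_ to _∈²?_)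

-- Quarter-integers as rationals.

¼*_ : ℤ → ℚ
-- `mkℚᵘ` stores the denominator minus one, so `3` means a denominator of 4.
¼* z = ℚ.fromℚᵘ (ℚᵘ.mkℚᵘ z 3)

¼-toℚᵘ : ∀ z → ℚ.toℚᵘ (¼* z) ℚᵘ.≃ ℚᵘ.mkℚᵘ z 3
¼-toℚᵘ z = ℚ.toℚᵘ-fromℚᵘ (ℚᵘ.mkℚᵘ z 3)

¼-mono-< : ∀ {z w} → z ℤ.< w → ¼* z <ℚ ¼* w
¼-mono-< {z} {w} z<w = ℚ.toℚᵘ-cancel-<
  (ℚᵘ.<-respʳ-≃ (ℚᵘ.≃-sym (¼-toℚᵘ w)) (ℚᵘ.<-respˡ-≃ (ℚᵘ.≃-sym (¼-toℚᵘ z))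
    (ℚᵘ.*<* (ℤ.*-monoʳ-<-pos (+ 4) z<w))))

¼-mono-≤ : ∀ {z w} → z ℤ.≤ w → ¼* z ≤ℚ ¼* w
¼-mono-≤ {z} {w} z≤w with z ℤ.≟ w
... | yes refl = ℚ.≤-refl
... | no  z≢w  = ℚ.<⇒≤ (¼-mono-< (ℤ.≤∧≢⇒< z≤w z≢w))

¼-cancel-< : ∀ {z w} → ¼* z <ℚ ¼* w → z ℤ.< w
¼-cancel-< {z} {w} lt with z ℤ.<? w
... | yes z<w = z<w
... | no  z≮w = contradiction (ℚ.<-≤-trans lt (¼-mono-≤ (ℤ.≮⇒≥ z≮w))) (ℚ.<-irrefl refl)

¼-side : ∀ z → ¼* (z ℤ.+ + 4) ≡ ¼* z ℚ.+ 1ℚ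
¼-side z = ℚ.toℚᵘ-injective (ℚᵘ.≃-trans (¼-toℚᵘ (z ℤ.+ + 4)) (ℚᵘ.≃-trans (ℚᵘ.*≡* (eq z))
  (ℚᵘ.≃-sym (ℚᵘ.≃-trans (ℚ.toℚᵘ-homo-+ (¼* z) 1ℚ) (ℚᵘ.+-congˡ ℚᵘ.1ℚᵘ (¼-toℚᵘ z))))))
  where
  eq : ∀ z → (z ℤ.+ + 4) ℤ.* + 4 ≡ (z ℤ.* + 1 ℤ.+ + 1 ℤ.* + 4) ℤ.* + 4
  eq = solve-∀

-- Rational cuts, and comparison of reals with rationals.

ι : ℚ → ℝ
ι p = record
  { lower           = _<ℚ p
  ; upper           = p <ℚ_
  ; lower-inhabited = p ℚ.- 1ℚ , subst (p ℚ.- 1ℚ <ℚ_) (ℚ.+-identityʳ p) (ℚ.+-monoʳ-< p (ℚ.negative⁻¹ (ℚ.- 1ℚ)))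
  ; upper-inhabited = p ℚ.+ 1ℚ , subst (_<ℚ p ℚ.+ 1ℚ) (ℚ.+-identityʳ p) (ℚ.+-monoʳ-< p (ℚ.positive⁻¹ 1ℚ))
  ; lower-rounded   = λ q → mk⇔ ℚ.<-dense (λ (r , q<r , r<p) → ℚ.<-trans q<r r<p)
  ; upper-rounded   = λ q → mk⇔ (λ p<q → let r , p<r , r<q = ℚ.<-dense p<q in r , r<q , p<r)
                                (λ (r , r<q , p<r) → ℚ.<-trans p<r r<q)
  ; disjoint        = λ q (q<p , p<q) → ℚ.<-asym q<p p<q
  ; located         = loc
  }
  where
  loc : ∀ {q r} → q <ℚ r → q <ℚ p ⊎ p <ℚ r
  loc {q} {r} q<r with q ℚ.<? p
  ... | yes q<p = inj₁ q<p
  ... | no  q≮p = inj₂ (ℚ.≤-<-trans (ℚ.≮⇒≥ q≮p) q<r)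

ι-mono-< : ∀ {p q} → p <ℚ q → ι p <ᴿ ι q
ι-mono-< = ℚ.<-dense

ι-cancel-< : ∀ {p q} → ι p <ᴿ ι q → p <ℚ q
ι-cancel-< (r , p<r , r<q) = ℚ.<-trans p<r r<q

lower-< : ∀ x {q r} → q <ℚ r → lower x r → lower x q
lower-< x q<r lr = Equivalence.from (lower-rounded x _) (_ , q<r , lr)

upper-< : ∀ x {q r} → q <ℚ r → upper x q → upper x r
upper-< x q<r uq = Equivalence.from (upper-rounded x _) (_ , q<r , uq)

lower<upper : ∀ x {q r} → lower x q → upper x r → q <ℚ r
lower<upper x {q} {r} lq ur with ℚ.<-cmp q r
... | tri< q<r _ _  = q<r
... | tri≈ _ refl _ = ⊥-elim (disjoint x _ (lq , ur))
... | tri> _ _ r<q  = ⊥-elim (disjoint x _ (lower-< x r<q lq , ur))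

lower⇒ι< : ∀ x {q} → lower x q → ι q <ᴿ x
lower⇒ι< x lq = Equivalence.to (lower-rounded x _) lq

upper⇒<ι : ∀ x {q} → upper x q → x <ᴿ ι q
upper⇒<ι x uq = let r , r<q , ur = Equivalence.to (upper-rounded x _) uq in r , ur , r<q

ι<⇒lower : ∀ x {q} → ι q <ᴿ x → lower x q
ι<⇒lower x (r , q<r , lr) = lower-< x q<r lr

<ι⇒upper : ∀ x {q} → x <ᴿ ι q → upper x q
<ι⇒upper x (r , ur , r<q) = upper-< x r<q ur

-ʳ⇒< : ∀ {q p} → q ℚ.- 1ℚ <ℚ p → q <ℚ p ℚ.+ 1ℚ
-ʳ⇒< {q} {p} lt = subst (_<ℚ p ℚ.+ 1ℚ) eq (ℚ.+-monoˡ-< 1ℚ lt)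
  where
  eq : q ℚ.- 1ℚ ℚ.+ 1ℚ ≡ q
  eq = trans (ℚ.+-assoc q (ℚ.- 1ℚ) 1ℚ) (ℚ.+-identityʳ q)

<⇒-ʳ : ∀ {q p} → q <ℚ p ℚ.+ 1ℚ → q ℚ.- 1ℚ <ℚ p
<⇒-ʳ {q} {p} lt = subst (q ℚ.- 1ℚ <ℚ_) eq (ℚ.+-monoˡ-< (ℚ.- 1ℚ) lt)
  where
  eq : p ℚ.+ 1ℚ ℚ.- 1ℚ ≡ p
  eq = trans (ℚ.+-assoc p 1ℚ (ℚ.- 1ℚ)) (ℚ.+-identityʳ p)

<-side⇒upper : ∀ x z → x <ᴿ ι (¼* z) +ʳ 1ℚ → upper x (¼* (z ℤ.+ + 4))
<-side⇒upper x z (q , uq , lt) = subst (upper x) (sym (¼-side z)) (upper-< x (-ʳ⇒< lt) uq)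

upper⇒<-side : ∀ x z → upper x (¼* (z ℤ.+ + 4)) → x <ᴿ ι (¼* z) +ʳ 1ℚ
upper⇒<-side x z u =
  let r , ur , r< = upper⇒<ι x u in r , ur , <⇒-ʳ (subst (r <ℚ_) (¼-side z) r<)

lower-≤ : ∀ x {q r} → q ≤ℚ r → lower x r → lower x q
lower-≤ x {q} {r} q≤r lr with q ℚ.≟ r
... | yes refl = lr
... | no  q≢r  = lower-< x (ℚ.≰⇒> λ r≤q → q≢r (ℚ.≤-antisym q≤r r≤q)) lr

upper-≤ : ∀ x {q r} → q ≤ℚ r → upper x q → upper x r
upper-≤ x {q} {r} q≤r uq with q ℚ.≟ r
... | yes refl = uq
... | no  q≢r  = upper-< x (ℚ.≰⇒> λ r≤q → q≢r (ℚ.≤-antisym q≤r r≤q)) uq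

between-min : ∀ {p q r} → p <ℚ q → p <ℚ r → ∃[ m ] p <ℚ m × m <ℚ q × m <ℚ r
between-min {p} {q} {r} p<q p<r with ℚ.≤-total q r
... | inj₁ q≤r = let m , p<m , m<q = ℚ.<-dense p<q in m , p<m , m<q , ℚ.<-≤-trans m<q q≤r
... | inj₂ r≤q = let m , p<m , m<r = ℚ.<-dense p<r in m , p<m , ℚ.<-≤-trans m<r r≤q , m<r

-- Locating a rational between consecutive quarter-integers.

<suc⇒≤ : ∀ {i j} → i ℤ.< ℤ.suc j → i ℤ.≤ j
<suc⇒≤ {i} {j} lt = subst (i ℤ.≤_) (ℤ.pred-suc j) (ℤ.i<j⇒i≤pred[j] lt)

i<suc[i] : ∀ i → i ℤ.< ℤ.suc i
i<suc[i] i = ℤ.suc[i]≤j⇒i<j ℤ.≤-refl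

-- The interval is searched quarter by quarter from below, each comparison being decidable in ℚ.
quarter-floor : ∀ m z {q} → ¼* z ≤ℚ q → q <ℚ ¼* (z ℤ.+ + m) →
  ∃[ j ] ¼* (z ℤ.+ + toℕ {m} j) ≤ℚ q × q <ℚ ¼* ℤ.suc (z ℤ.+ + toℕ j)
quarter-floor zero z z≤q q<z rewrite ℤ.+-identityʳ z = contradiction (ℚ.≤-<-trans z≤q q<z) (ℚ.<-irrefl refl)
quarter-floor (suc m) z {q} z≤q q<z+m with q ℚ.<? ¼* ℤ.suc z
... | yes q<z+1 =
  zero , subst (λ i → ¼* i ≤ℚ q) eq z≤q , subst (λ i → q <ℚ ¼* ℤ.suc i) eq q<z+1
  where eq = sym (ℤ.+-identityʳ z)
... | no  q≮z+1 =
  let j , lo , hi = quarter-floor m (ℤ.suc z) (ℚ.≮⇒≥ q≮z+1) (subst (λ i → q <ℚ ¼* i) (shift z (+ m)) q<z+m)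
      eq = sym (shift z (+ toℕ j))
  in suc j , subst (λ i → ¼* i ≤ℚ q) eq lo , subst (λ i → q <ℚ ¼* ℤ.suc i) eq hi
  where
  shift : ∀ z i → z ℤ.+ (1ℤ ℤ.+ i) ≡ (1ℤ ℤ.+ z) ℤ.+ i
  shift = solve-∀

z<z+ : ∀ z k → z ℤ.< z ℤ.+ + suc k
z<z+ z k = subst (ℤ._< z ℤ.+ + suc k) (ℤ.+-identityʳ z) (ℤ.+-monoʳ-< z (ℤ.+<+ (ℕ.s≤s ℕ.z≤n)))

-- Visibility between squares at quarter-integer positions.

module Visibility {n : ℕ} (X Y : Fin n → ℤ) where

  placed : Fin n → Square
  placed v = square (ι (¼* X v)) (ι (¼* Y v))

  -- Row `t` is the horizontal strip between the heights t/4 and (t+1)/4. All edges lie at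
  -- quarter-integers, so a square either spans a row in height or misses its interior.
  Meets : Fin n → ℤ → Set
  Meets v t = Y v ℤ.≤ t × t ℤ.< Y v ℤ.+ + 4

  meets? : ∀ v t → Dec (Meets v t)
  meets? v t = Y v ℤ.≤? t ×-dec t ℤ.<? Y v ℤ.+ + 4

  -- All squares have the same width, so left edges decide: if the closed gap from `X v + 4` to
  -- `X w` is nonempty, the open interval from `X u` to `X u + 4` meets it iff `X v < X u` and
  -- `X u < X w`.
  Obstructs : Fin n → Fin n → Fin n → Set
  Obstructs v w u = X v ℤ.+ + 4 ℤ.≤ X w × X v ℤ.< X u × X u ℤ.< X w

  obstructs? : ∀ v w u → Dec (Obstructs v w u)
  obstructs? v w u = X v ℤ.+ + 4 ℤ.≤? X w ×-dec X v ℤ.<? X u ×-dec X u ℤ.<? X w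

  ClearAt : Fin n → Fin n → ℤ → Set
  ClearAt v w t = Meets v t × Meets w t ×
    (∀ u → u ≢ v → u ≢ w → Meets u t → ¬ (Obstructs v w u ⊎ Obstructs w v u))

  clearAt? : ∀ v w t → Dec (ClearAt v w t)
  clearAt? v w t = meets? v t ×-dec meets? w t ×-dec
    Fin.all? λ u → ¬? (u Fin.≟ v) →-dec (¬? (u Fin.≟ w) →-dec
      (meets? u t →-dec ¬? (obstructs? v w u ⊎-dec obstructs? w v u)))

  -- A common row is one of the four rows of `v`, which keeps visibility decidable.
  Sees : Fin n → Fin n → Set
  Sees v w = ∃[ j ] ClearAt v w (Y v ℤ.+ + toℕ {4} j)

  sees? : ∀ v w → Dec (Sees v w)
  sees? v w = Fin.any? λ j → clearAt? v w (Y v ℤ.+ + toℕ {4} j)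

  interior : ∀ v {x y} → lower x (¼* X v) → upper x (¼* (X v ℤ.+ + 4)) →
    lower y (¼* Y v) → upper y (¼* (Y v ℤ.+ + 4)) → Interior (placed v) x y
  interior v {x} {y} lx ux ly uy =
    (lower⇒ι< x lx , upper⇒<-side x (X v) ux) , (lower⇒ι< y ly , upper⇒<-side y (Y v) uy)

  interior⁻¹ : ∀ v {x y} → Interior (placed v) x y →
    (lower x (¼* X v) × upper x (¼* (X v ℤ.+ + 4))) × (lower y (¼* Y v) × upper y (¼* (Y v ℤ.+ + 4)))
  interior⁻¹ v {x} {y} ((lx , ux) , (ly , uy)) =
    (ι<⇒lower x lx , <-side⇒upper x (X v) ux) , (ι<⇒lower y ly , <-side⇒upper y (Y v) uy)

  -- The order of the real `x` is not decidable, so each integer inequality is decided instead, and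
  -- its failure is refuted by means of the cut `x`.
  between⇒obstructs : ∀ v w u {x} → right (placed v) ≤ᴿ x → x ≤ᴿ left (placed w) →
    lower x (¼* X u) → upper x (¼* (X u ℤ.+ + 4)) → Obstructs v w u
  between⇒obstructs v w u {x} v≤x x≤w lu uu = gap , v<u , u<w
    where
    ¬uv : ¬ upper x (¼* (X v ℤ.+ + 4))
    ¬uv = v≤x ∘ upper⇒<-side x (X v)
    ¬lw : ¬ lower x (¼* X w)
    ¬lw = x≤w ∘ lower⇒ι< x
    gap : X v ℤ.+ + 4 ℤ.≤ X w
    gap with X v ℤ.+ + 4 ℤ.≤? X w
    ... | yes le = le
    -- If the gap were negative, locatedness of `x` on the interval from `X w` to `X v + 4` would
    -- violate one of its two bounds.
    ... | no  ≰  = ⊥-elim (Sum.[ ¬lw , ¬uv ] (located x (¼-mono-< (ℤ.≰⇒> ≰))))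
    v<u : X v ℤ.< X u
    v<u with X v ℤ.<? X u
    ... | yes lt = lt
    ... | no  ≮  = ⊥-elim (¬uv (upper-≤ x (¼-mono-≤ (ℤ.+-monoˡ-≤ (+ 4) (ℤ.≮⇒≥ ≮))) uu))
    u<w : X u ℤ.< X w
    u<w with X u ℤ.<? X w
    ... | yes lt = lt
    ... | no  ≮  = ⊥-elim (¬lw (lower-≤ x (¼-mono-≤ (ℤ.≮⇒≥ ≮)) lu))

  obstructs⇒between : ∀ v w u → Obstructs v w u → ∃[ x ]
    right (placed v) ≤ᴿ x × x ≤ᴿ left (placed w) × lower x (¼* X u) × upper x (¼* (X u ℤ.+ + 4))
  obstructs⇒between v w u (gap , v<u , u<w) =
    let c , v≤c , c≤w , u<c , c<u = point in
    ι (¼* c)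
    , (λ lt → ℚ.<-irrefl refl (ℚ.<-≤-trans (<-side⇒upper (ι (¼* c)) (X v) lt) (¼-mono-≤ v≤c)))
    , (λ lt → ℚ.<-irrefl refl (ℚ.<-≤-trans (ι-cancel-< lt) (¼-mono-≤ c≤w)))
    , ¼-mono-< u<c , ¼-mono-< c<u
    where
    -- If `u` starts before the right edge of `v`, that edge is the point; otherwise the point is
    -- one quarter inside `u`.
    point : ∃[ c ] X v ℤ.+ + 4 ℤ.≤ c × c ℤ.≤ X w × X u ℤ.< c × c ℤ.< X u ℤ.+ + 4
    point with X u ℤ.<? X v ℤ.+ + 4
    ... | yes lt = X v ℤ.+ + 4 , ℤ.≤-refl , gap , lt , ℤ.+-monoˡ-< (+ 4) v<u
    ... | no  ≮  = ℤ.suc (X u) , ℤ.i≤j⇒i≤1+j (ℤ.≮⇒≥ ≮) , ℤ.i<j⇒suc[i]≤j u<w , i<suc[i] (X u)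
                 , subst (ℤ._< X u ℤ.+ + 4) (ℤ.+-comm (X u) 1ℤ) (ℤ.+-monoʳ-< (X u) (ℤ.+<+ (ℕ.s≤s (ℕ.s≤s ℕ.z≤n))))

  -- The band is the open row itself: as no edge lies strictly inside a row, each of its lines meets
  -- exactly the squares that meet row `t`.
  clear⇒band : ∀ v w t → ClearAt v w t → HorizontalBand placed v w
  clear⇒band v w t (mv , mw , free) =
    ι (¼* t) , ι (¼* ℤ.suc t) , ι-mono-< (¼-mono-< (i<suc[i] t)) , λ y t<y y<t+1 →
      let ly = ι<⇒lower y t<y
          uy = <ι⇒upper y y<t+1
      in midpoint v mv {y} ly uy , midpoint w mw {y} ly uy , λ u u≢v u≢w (x , btw , int) →
        let (lx , ux) , (ly′ , uy′) = interior⁻¹ u {x} {y} int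
            meets = <suc⇒≤ (¼-cancel-< (lower<upper y ly′ uy)) , ¼-cancel-< (lower<upper y ly uy′)
        in free u u≢v u≢w meets
             (Sum.map (λ (v≤x , x≤w) → between⇒obstructs v w u {x} v≤x x≤w lx ux)
                      (λ (w≤x , x≤v) → between⇒obstructs w v u {x} w≤x x≤v lx ux) btw)
    where
    midpoint : ∀ u → Meets u t → ∀ {y} → lower y (¼* t) → upper y (¼* ℤ.suc t) → ∃[ x ] Interior (placed u) x y
    midpoint u (lo , hi) {y} ly uy = ι (¼* (X u ℤ.+ + 1)) ,
      interior u {ι (¼* (X u ℤ.+ + 1))} {y} (¼-mono-< (z<z+ (X u) 0))
        (¼-mono-< (ℤ.+-monoʳ-< (X u) (ℤ.+<+ (ℕ.s≤s (ℕ.s≤s ℕ.z≤n)))))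
        (lower-≤ y (¼-mono-≤ lo) ly) (upper-≤ y (¼-mono-≤ (ℤ.i<j⇒suc[i]≤j hi)) uy)

  -- A rational `q` of the band is rounded down to a row of `v`; a line of the band inside that row
  -- shows that the row is clear.
  band⇒sees : ∀ v w → HorizontalBand placed v w → Sees v w
  band⇒sees v w (a , b , (q , uq , lq) , band) =
    let r , q<r , lr = Equivalence.to (lower-rounded b q) lq
        (xv , iv) , (xw , iw) , _ = band (ι q) (upper⇒<ι a uq) (lower⇒ι< b lq)
        _ , v<q , q<v = interior⁻¹ v {xv} {ι q} iv
        _ , w<q , q<w = interior⁻¹ w {xw} {ι q} iw
        j , t≤q , q<t+1 = quarter-floor 4 (Y v) (ℚ.<⇒≤ v<q) q<v
        t = Y v ℤ.+ + toℕ j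
        -- `q` may lie on the lower edge of its row, where another square can begin. A slightly
        -- higher `y` is strictly inside both the row and the band.
        y , q<y , y<r , y<t+1 = between-min q<r q<t+1
        _ , _ , free = band (ι y) (upper⇒<ι a (upper-< a q<y uq)) (lower⇒ι< b (lower-< b y<r lr))
        meets : ∀ u → ¼* Y u <ℚ q → q <ℚ ¼* (Y u ℤ.+ + 4) → Meets u t
        meets u u<q q<u = <suc⇒≤ (¼-cancel-< (ℚ.<-trans u<q q<t+1)) , ¼-cancel-< (ℚ.≤-<-trans t≤q q<u)
        inside : ∀ u → Meets u t → ∀ {x} → lower x (¼* X u) → upper x (¼* (X u ℤ.+ + 4)) → Interior (placed u) x (ι y)
        inside u (lo , hi) {x} lx ux = interior u {x} {ι y} lx ux
          (ℚ.≤-<-trans (ℚ.≤-trans (¼-mono-≤ lo) t≤q) q<y)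
          (ℚ.<-≤-trans y<t+1 (¼-mono-≤ (ℤ.i<j⇒suc[i]≤j hi)))
    in j , meets v v<q q<v , meets w w<q q<w , λ u u≢v u≢w mu → λ
      { (inj₁ ob) → let x , v≤x , x≤w , lx , ux = obstructs⇒between v w u ob in
          free u u≢v u≢w (x , inj₁ (v≤x , x≤w) , inside u mu {x} lx ux)
      ; (inj₂ ob) → let x , w≤x , x≤v , lx , ux = obstructs⇒between w v u ob in
          free u u≢v u≢w (x , inj₂ (w≤x , x≤v) , inside u mu {x} lx ux) }

  -- Passing through the band turns an arbitrary row `t` into one of the four offsets from `Y v`.
  -- Symmetry needs this, since `v` and `w` count their rows from different bases.
  clear⇒sees : ∀ v w t → ClearAt v w t → Sees v w
  clear⇒sees v w t c = band⇒sees v w (clear⇒band v w t c)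

  sees⇔band : ∀ v w → Sees v w ⇔ HorizontalBand placed v w
  sees⇔band v w = mk⇔ (λ (j , c) → clear⇒band v w _ c) (band⇒sees v w)

  clear-sym : ∀ v w t → ClearAt v w t → ClearAt w v t
  clear-sym v w t (mv , mw , free) = mw , mv , λ u u≢w u≢v mu → free u u≢v u≢w mu ∘ Sum.swap

  sees-sym : ∀ {v w} → Sees v w → Sees w v
  sees-sym {v} {w} (j , c) = clear⇒sees w v _ (clear-sym v w _ c)

-- Lattice differences and finite checks of lines of sight.

Cell : Set
Cell = ℕ × ℕ

_≟ᶜ_ : DecidableEquality Cell
_≟ᶜ_ = ≡-dec ℕ._≟_ ℕ._≟_

<⇒≡+suc : ∀ {i j} → i ℤ.< j → ∃[ k ] j ≡ i ℤ.+ + suc k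
<⇒≡+suc {i} {j} i<j with j ℤ.- ℤ.suc i in eq | ℤ.i≤j⇒0≤j-i (ℤ.i<j⇒suc[i]≤j i<j)
... | + k | _ = k , trans (sym (split i j)) (cong (λ d → i ℤ.+ (1ℤ ℤ.+ d)) eq)
  where
  split : ∀ i j → i ℤ.+ (1ℤ ℤ.+ (j ℤ.- (1ℤ ℤ.+ i))) ≡ j
  split = solve-∀

≤⇒≡+ : ∀ {i j} → i ℤ.≤ j → ∃[ k ] j ≡ i ℤ.+ + k
≤⇒≡+ {i} {j} i≤j with j ℤ.- i in eq | ℤ.i≤j⇒0≤j-i i≤j
... | + k | _ = k , trans (sym (split i j)) (cong (λ d → i ℤ.+ d) eq)
  where
  split : ∀ i j → i ℤ.+ (j ℤ.- i) ≡ j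
  split = solve-∀

+-cancelˡ-< : ∀ i {m n} → i ℤ.+ + m ℤ.< i ℤ.+ + n → m ℕ.< n
+-cancelˡ-< i lt = ℤ.drop‿+<+ (subst₂ ℤ._<_ (cancel i _) (cancel i _) (ℤ.+-monoʳ-< (ℤ.- i) lt))
  where
  cancel : ∀ i j → ℤ.- i ℤ.+ (i ℤ.+ j) ≡ j
  cancel = solve-∀

-- The lattice spanned by (5, -2) and (2, 5) consists of the (p , q) with
-- 29 ∣ 5p - 2q; after a quarter turn the condition is 29 ∣ 5p + 2q.
OnLattice : ℤ → ℤ → ℤ → Set
OnLattice β p q = 29 ∣ ℤ.∣ + 5 ℤ.* p ℤ.+ β ℤ.* q ∣

onLattice? : ∀ β p q → Dec (OnLattice β p q)
onLattice? β p q = 29 ∣? ℤ.∣ + 5 ℤ.* p ℤ.+ β ℤ.* q ∣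

-- Relative to a square at the origin: the line q = τ meets it and the square
-- at (suc δ , ε), and no lattice point outside bad obstructs it in between.
FreeLine : ℤ → ℕ → ℤ → ℕ → List (ℤ × ℤ) → Set
FreeLine β δ ε τ bad = (ε ℤ.≤ + τ × + τ ℤ.< ε ℤ.+ + 4 × τ ℕ.< 4) ×
  (∀ (i : Fin δ) (j : Fin 4) → OnLattice β (+ suc (toℕ i)) (+ τ ℤ.- + toℕ j) →
    (+ suc (toℕ i) , + τ ℤ.- + toℕ j) ∈ bad)

freeLine? : ∀ β δ ε τ bad → Dec (FreeLine β δ ε τ bad)
freeLine? β δ ε τ bad = (ε ℤ.≤? + τ ×-dec + τ ℤ.<? ε ℤ.+ + 4 ×-dec τ ℕ.<? 4) ×-dec
  Fin.all? λ i → Fin.all? λ j → onLattice? β (+ suc (toℕ i)) (+ τ ℤ.- + toℕ j) →-dec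
    ((+ suc (toℕ i) , + τ ℤ.- + toℕ j) ∈²? bad)

-- `Fin 7` shifted by 3 runs from -3 to 3, the integer offsets at which intervals of length 4
-- overlap. So zero is the only lattice vector at which two squares overlap.
Sparse : ℤ → Set
Sparse β = ∀ (i j : Fin 7) → OnLattice β (+ toℕ i ℤ.- + 3) (+ toℕ j ℤ.- + 3) → toℕ i ≡ 3 × toℕ j ≡ 3

sparse? : ∀ β → Dec (Sparse β)
sparse? β = Fin.all? λ i → Fin.all? λ j → onLattice? β (+ toℕ i ℤ.- + 3) (+ toℕ j ℤ.- + 3) →-dec
  (toℕ i ℕ.≟ 3 ×-dec toℕ j ℕ.≟ 3)

-- `P` is the coordinate along the line of sight and `Q` the one across it. The modulus 29 is the
-- determinant of the lattice basis, and `index` is a cell coordinate, recovered as in Cramer's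
-- rule.
module Lattice {n : ℕ} (P Q : Fin n → ℤ) (β : ℤ)
  (index : Fin n → ℤ) (index-spec : ∀ v → + 5 ℤ.* P v ℤ.+ β ℤ.* Q v ≡ index v ℤ.* + 29)
  where

  open Visibility P Q

  difference : ∀ v u {p q} → P u ≡ P v ℤ.+ p → Q u ≡ Q v ℤ.+ q → OnLattice β p q
  difference v u {p} {q} eqp eqq = subst (29 ∣_) (cong ℤ.∣_∣ eq)
    (subst (29 ∣_) (sym (ℤ.abs-* (index u ℤ.- index v) (+ 29))) (∣n⇒∣m*n ℤ.∣ index u ℤ.- index v ∣ ∣-refl))
    where
    open ≡-Reasoning
    distrib : ∀ a b → (a ℤ.- b) ℤ.* + 29 ≡ a ℤ.* + 29 ℤ.- b ℤ.* + 29
    distrib = solve-∀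
    cancel : ∀ a b p q β → + 5 ℤ.* (a ℤ.+ p) ℤ.+ β ℤ.* (b ℤ.+ q) ℤ.- (+ 5 ℤ.* a ℤ.+ β ℤ.* b) ≡ + 5 ℤ.* p ℤ.+ β ℤ.* q
    cancel = solve-∀
    eq : (index u ℤ.- index v) ℤ.* + 29 ≡ + 5 ℤ.* p ℤ.+ β ℤ.* q
    eq = begin
      (index u ℤ.- index v) ℤ.* + 29 ≡⟨ distrib (index u) (index v) ⟩
      index u ℤ.* + 29 ℤ.- index v ℤ.* + 29 ≡⟨ cong₂ ℤ._-_ (sym (index-spec u)) (sym (index-spec v)) ⟩
      + 5 ℤ.* P u ℤ.+ β ℤ.* Q u ℤ.- (+ 5 ℤ.* P v ℤ.+ β ℤ.* Q v)
        ≡⟨ cong (ℤ._- (+ 5 ℤ.* P v ℤ.+ β ℤ.* Q v)) (cong₂ (λ a b → + 5 ℤ.* a ℤ.+ β ℤ.* b) eqp eqq) ⟩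
      + 5 ℤ.* (P v ℤ.+ p) ℤ.+ β ℤ.* (Q v ℤ.+ q) ℤ.- (+ 5 ℤ.* P v ℤ.+ β ℤ.* Q v) ≡⟨ cancel (P v) (Q v) p q β ⟩
      + 5 ℤ.* p ℤ.+ β ℤ.* q ∎

  -- A blocking square has an offset between 1 and `δ` along the line and `τ - j` with `j < 4`
  -- across it. This offset is a lattice vector, so the finite check, evaluated in the implicit
  -- argument, puts it into `bad`.
  sees-along : ∀ δ ε τ bad {_ : True (freeLine? β δ ε τ bad)} v w →
    P w ≡ P v ℤ.+ + suc δ → Q w ≡ Q v ℤ.+ ε →
    (∀ u {p q} → (p , q) ∈ bad → P u ≡ P v ℤ.+ p → Q u ≡ Q v ℤ.+ q → ⊥) →
    Sees v w
  sees-along δ ε τ bad {line} v w eqp eqq absent =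
    clear⇒sees v w (Q v ℤ.+ + τ) (meets-v , meets-w , λ u _ _ mu → λ
      { (inj₁ (_ , v<u , u<w)) → blocked u mu v<u u<w
      ; (inj₂ (_ , w<u , u<v)) → ℤ.<-asym (ℤ.<-trans w<u u<v) v<w })
    where
    ε≤τ = proj₁ (proj₁ (toWitness line))
    τ<ε+4 = proj₁ (proj₂ (proj₁ (toWitness line)))
    τ<4 = proj₂ (proj₂ (proj₁ (toWitness line)))
    free = proj₂ (toWitness line)
    meets-v : Meets v (Q v ℤ.+ + τ)
    meets-v = ℤ.i≤i+j (Q v) (+ τ) , ℤ.+-monoʳ-< (Q v) (ℤ.+<+ τ<4)
    meets-w : Meets w (Q v ℤ.+ + τ)
    meets-w rewrite eqq = ℤ.+-monoʳ-≤ (Q v) ε≤τ ,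
      subst (Q v ℤ.+ + τ ℤ.<_) (sym (ℤ.+-assoc (Q v) ε (+ 4))) (ℤ.+-monoʳ-< (Q v) τ<ε+4)
    v<w : P v ℤ.< P w
    v<w rewrite eqp = z<z+ (P v) δ
    blocked : ∀ u → Meets u (Q v ℤ.+ + τ) → P v ℤ.< P u → P u ℤ.< P w → ⊥
    blocked u (lo , hi) v<u u<w = absent u inbad eqp′ eqq′
      where
      k = proj₁ (<⇒≡+suc v<u)
      eqk = proj₂ (<⇒≡+suc v<u)
      m = proj₁ (≤⇒≡+ lo)
      eqm = proj₂ (≤⇒≡+ lo)
      k<δ : k ℕ.< δ
      k<δ = ℕ.≤-pred (+-cancelˡ-< (P v) (subst₂ ℤ._<_ eqk eqp u<w))
      m<4 : m ℕ.< 4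
      m<4 = +-cancelˡ-< (Q u) (subst (ℤ._< Q u ℤ.+ + 4) eqm hi)
      i = fromℕ< k<δ
      j = fromℕ< m<4
      eqp′ : P u ≡ P v ℤ.+ + suc (toℕ i)
      eqp′ = trans eqk (cong (λ k → P v ℤ.+ + suc k) (sym (Fin.toℕ-fromℕ< k<δ)))
      move : ∀ a b t m → a ℤ.+ t ≡ b ℤ.+ m → b ≡ a ℤ.+ (t ℤ.- m)
      move a b t m eq = trans (sym (cancel b m)) (trans (cong (ℤ._- m) (sym eq)) (ℤ.+-assoc a t (ℤ.- m)))
        where
        cancel : ∀ b m → (b ℤ.+ m) ℤ.- m ≡ b
        cancel = solve-∀
      eqq′ : Q u ≡ Q v ℤ.+ (+ τ ℤ.- + toℕ j)
      eqq′ = move (Q v) (Q u) (+ τ) (+ toℕ j)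
        (trans eqm (cong (λ m → Q u ℤ.+ + m) (sym (Fin.toℕ-fromℕ< m<4))))
      inbad = free i j (difference v u eqp′ eqq′)

  separated : Sparse β →
    ∀ v w → P v ℤ.< P w ℤ.+ + 4 → P w ℤ.< P v ℤ.+ + 4 → Q v ℤ.< Q w ℤ.+ + 4 → Q w ℤ.< Q v ℤ.+ + 4 →
    P v ≡ P w × Q v ≡ Q w
  separated sparse v w p₁ p₂ q₁ q₂ =
    let i , eqp = offset (P v) (P w) p₁ p₂
        j , eqq = offset (Q v) (Q w) q₁ q₂
        i≡3 , j≡3 = sparse i j (difference v w eqp eqq)
    in same eqp i≡3 , same eqq j≡3
    where
    same : ∀ {a b} {i : Fin 7} → b ≡ a ℤ.+ (+ toℕ i ℤ.- + 3) → toℕ i ≡ 3 → a ≡ b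
    same {a} eq i≡3 rewrite i≡3 = sym (trans eq (ℤ.+-identityʳ a))
    offset : ∀ a b → a ℤ.< b ℤ.+ + 4 → b ℤ.< a ℤ.+ + 4 → ∃[ i ] b ≡ a ℤ.+ (+ toℕ {7} i ℤ.- + 3)
    offset a b lt₁ lt₂ = i , trans (solve₁ b) (trans (cong (ℤ._- + 4) eqk)
        (trans (solve₂ a (+ k)) (cong (λ k → a ℤ.+ (+ k ℤ.- + 3)) (sym (Fin.toℕ-fromℕ< k<7)))))
      where
      k = proj₁ (<⇒≡+suc lt₁)
      eqk = proj₂ (<⇒≡+suc lt₁)
      solve₁ : ∀ b → b ≡ b ℤ.+ + 4 ℤ.- + 4
      solve₁ = solve-∀
      solve₂ : ∀ a k → a ℤ.+ (1ℤ ℤ.+ k) ℤ.- + 4 ≡ a ℤ.+ (k ℤ.- + 3)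
      solve₂ = solve-∀
      k<7 : k ℕ.< 7
      k<7 = ℕ.≤-pred (+-cancelˡ-< a (subst₂ ℤ._<_ eqk (ℤ.+-assoc a (+ 4) (+ 4)) (ℤ.+-monoˡ-< (+ 4) lt₂)))
      i = fromℕ< k<7

-- Cells placed in the plane, and the steps between cells that see each other.

posX posY : Cell → ℤ
posX (x , y) = + 5 ℤ.* + x ℤ.+ + 2 ℤ.* + y
posY (x , y) = + 5 ℤ.* + y ℤ.- + 2 ℤ.* + x

-- Together with `posY-lattice` this inverts the change of basis: it supplies the `index-spec` of
-- the lattice and the injectivity of the placement.
posX-lattice : ∀ c → + 5 ℤ.* posX c ℤ.+ ℤ.- + 2 ℤ.* posY c ≡ + proj₁ c ℤ.* + 29
posX-lattice (x , y) = ring (+ x) (+ y)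
  where
  ring : ∀ a b → + 5 ℤ.* (+ 5 ℤ.* a ℤ.+ + 2 ℤ.* b) ℤ.+ ℤ.- + 2 ℤ.* (+ 5 ℤ.* b ℤ.- + 2 ℤ.* a) ≡ a ℤ.* + 29
  ring = solve-∀

posY-lattice : ∀ c → + 5 ℤ.* posY c ℤ.+ + 2 ℤ.* posX c ≡ + proj₂ c ℤ.* + 29
posY-lattice (x , y) = ring (+ x) (+ y)
  where
  ring : ∀ a b → + 5 ℤ.* (+ 5 ℤ.* b ℤ.- + 2 ℤ.* a) ℤ.+ + 2 ℤ.* (+ 5 ℤ.* a ℤ.+ + 2 ℤ.* b) ≡ b ℤ.* + 29
  ring = solve-∀

pos-injective : ∀ {c d} → posX c ≡ posX d → posY c ≡ posY d → c ≡ d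
pos-injective {c} {d} eqX eqY = cong₂ _,_
  (coordinate (trans (sym (posX-lattice c)) (trans (cong₂ (λ a b → + 5 ℤ.* a ℤ.+ ℤ.- + 2 ℤ.* b) eqX eqY) (posX-lattice d))))
  (coordinate (trans (sym (posY-lattice c)) (trans (cong₂ (λ a b → + 5 ℤ.* b ℤ.+ + 2 ℤ.* a) eqX eqY) (posY-lattice d))))
  where
  coordinate : ∀ {a b} → + a ℤ.* + 29 ≡ + b ℤ.* + 29 → a ≡ b
  coordinate eq = ℤ.+-injective (ℤ.*-cancelʳ-≡ _ _ (+ 29) eq)

-- The constructor names give the difference of the two cells.  A pair at
-- difference (3, 1) or (-1, 3) has several possible lines of sight; the one
-- used is obstructed by the indicated cell only.
data Step (Absent : Cell → Set) : Cell → Cell → Set where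
  ⟨1,0⟩  : ∀ {x y} → Step Absent (x , y) (1 + x , y)
  ⟨1,1⟩  : ∀ {x y} → Step Absent (x , y) (1 + x , 1 + y)
  ⟨2,1⟩  : ∀ {x y} → Step Absent (x , y) (2 + x , 1 + y)
  ⟨0,1⟩  : ∀ {x y} → Step Absent (x , y) (x , 1 + y)
  ⟨-1,1⟩ : ∀ {x y} → Step Absent (1 + x , y) (x , 1 + y)
  ⟨-1,2⟩ : ∀ {x y} → Step Absent (1 + x , y) (x , 2 + y)
  ⟨3,1⟩ˡ : ∀ {x y} → Absent (1 + x , y) → Step Absent (x , y) (3 + x , 1 + y)
  ⟨3,1⟩ʳ : ∀ {x y} → Absent (2 + x , 1 + y) → Step Absent (x , y) (3 + x , 1 + y)
  ⟨-1,3⟩ˡ : ∀ {x y} → Absent (1 + x , 1 + y) → Step Absent (1 + x , y) (x , 3 + y)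
  ⟨-1,3⟩ʳ : ∀ {x y} → Absent (x , 2 + y) → Step Absent (1 + x , y) (x , 3 + y)

Linked : (Cell → Set) → Cell → Cell → Set
Linked Absent c d = Step Absent c d ⊎ Step Absent d c

-- The visibility graph of an arrangement of cells.

module Arrangement {n : ℕ} (cell : Fin n → Cell) (cell-injective : ∀ {v w} → cell v ≡ cell w → v ≡ w) where

  module H = Visibility (posX ∘ cell) (posY ∘ cell)
  module V = Visibility (posY ∘ cell) (posX ∘ cell)

  private
    module HL = Lattice (posX ∘ cell) (posY ∘ cell) (ℤ.- + 2) (λ v → + proj₁ (cell v)) (posX-lattice ∘ cell)
    module VL = Lattice (posY ∘ cell) (posX ∘ cell) (+ 2) (λ v → + proj₂ (cell v)) (posY-lattice ∘ cell)

  Absent : Cell → Set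
  Absent c = ∀ u → cell u ≢ c

  private
    shift : ∀ (f : Cell → ℤ) {c d v w k} → f d ≡ f c ℤ.+ k → cell v ≡ c → cell w ≡ d → f (cell w) ≡ f (cell v) ℤ.+ k
    shift f eq refl refl = eq

    same : ∀ {i j k : ℤ} → i ≡ j → k ≡ j → i ≡ k
    same eq₁ eq₂ = trans eq₁ (sym eq₂)

    right-blocked : ∀ {c e p q} → posX e ≡ posX c ℤ.+ p → posY e ≡ posY c ℤ.+ q → Absent e → ∀ v → cell v ≡ c →
      ∀ u {p′ q′} → (p′ , q′) ∈ [ p , q ] → posX (cell u) ≡ posX (cell v) ℤ.+ p′ → posY (cell u) ≡ posY (cell v) ℤ.+ q′ → ⊥
    right-blocked eqX eqY absent v refl u (here refl) eqp eqq = absent u (pos-injective (same eqp eqX) (same eqq eqY))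

    up-blocked : ∀ {c e p q} → posY e ≡ posY c ℤ.+ p → posX e ≡ posX c ℤ.+ q → Absent e → ∀ v → cell v ≡ c →
      ∀ u {p′ q′} → (p′ , q′) ∈ [ p , q ] → posY (cell u) ≡ posY (cell v) ℤ.+ p′ → posX (cell u) ≡ posX (cell v) ℤ.+ q′ → ⊥
    up-blocked eqY eqX absent v refl u (here refl) eqp eqq = absent u (pos-injective (same eqq eqX) (same eqp eqY))

    X+ : ∀ i j x y → posX (i + x , j + y) ≡ posX (x , y) ℤ.+ posX (i , j)
    X+ i j x y = trans (cong₂ (λ a b → + 5 ℤ.* a ℤ.+ + 2 ℤ.* b) (ℤ.pos-+ i x) (ℤ.pos-+ j y)) (ring (+ i) (+ j) (+ x) (+ y))
      where
      ring : ∀ i j x y → + 5 ℤ.* (i ℤ.+ x) ℤ.+ + 2 ℤ.* (j ℤ.+ y) ≡ + 5 ℤ.* x ℤ.+ + 2 ℤ.* y ℤ.+ (+ 5 ℤ.* i ℤ.+ + 2 ℤ.* j)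
      ring = solve-∀

    Y+ : ∀ i j x y → posY (i + x , j + y) ≡ posY (x , y) ℤ.+ posY (i , j)
    Y+ i j x y = trans (cong₂ (λ a b → + 5 ℤ.* b ℤ.- + 2 ℤ.* a) (ℤ.pos-+ i x) (ℤ.pos-+ j y)) (ring (+ i) (+ j) (+ x) (+ y))
      where
      ring : ∀ i j x y → + 5 ℤ.* (j ℤ.+ y) ℤ.- + 2 ℤ.* (i ℤ.+ x) ≡ + 5 ℤ.* y ℤ.- + 2 ℤ.* x ℤ.+ (+ 5 ℤ.* j ℤ.- + 2 ℤ.* i)
      ring = solve-∀

    X- : ∀ j x y → posX (x , j + y) ≡ posX (1 + x , y) ℤ.+ (+ 2 ℤ.* + j ℤ.- + 5)
    X- j x y = trans (cong (λ b → + 5 ℤ.* + x ℤ.+ + 2 ℤ.* b) (ℤ.pos-+ j y)) (ring (+ j) (+ x) (+ y))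
      where
      ring : ∀ j x y → + 5 ℤ.* x ℤ.+ + 2 ℤ.* (j ℤ.+ y) ≡ + 5 ℤ.* (1ℤ ℤ.+ x) ℤ.+ + 2 ℤ.* y ℤ.+ (+ 2 ℤ.* j ℤ.- + 5)
      ring = solve-∀

    Y- : ∀ j x y → posY (x , j + y) ≡ posY (1 + x , y) ℤ.+ (+ 5 ℤ.* + j ℤ.+ + 2)
    Y- j x y = trans (cong (λ b → + 5 ℤ.* b ℤ.- + 2 ℤ.* + x) (ℤ.pos-+ j y)) (ring (+ j) (+ x) (+ y))
      where
      ring : ∀ j x y → + 5 ℤ.* (j ℤ.+ y) ℤ.- + 2 ℤ.* x ≡ + 5 ℤ.* y ℤ.- + 2 ℤ.* (1ℤ ℤ.+ x) ℤ.+ (+ 5 ℤ.* j ℤ.+ + 2)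
      ring = solve-∀

  -- The first two numbers are the image of the cell difference, along (less one) and across the
  -- line of sight; the third is a row on which the finite check succeeds. In the last four cases
  -- `bad` holds the image of the cell assumed absent.
  step⇒sees : ∀ {c d} → Step Absent c d → ∀ v w → cell v ≡ c → cell w ≡ d → H.Sees v w ⊎ V.Sees v w
  step⇒sees (⟨1,0⟩ {x} {y}) v w v≡ w≡ = inj₁ (HL.sees-along 4 (ℤ.- + 2) 0 [] v w
    (shift posX (X+ 1 0 x y) v≡ w≡) (shift posY (Y+ 1 0 x y) v≡ w≡) λ u ())
  step⇒sees (⟨1,1⟩ {x} {y}) v w v≡ w≡ = inj₁ (HL.sees-along 6 (+ 3) 3 [] v w
    (shift posX (X+ 1 1 x y) v≡ w≡) (shift posY (Y+ 1 1 x y) v≡ w≡) λ u ())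
  step⇒sees (⟨2,1⟩ {x} {y}) v w v≡ w≡ = inj₁ (HL.sees-along 11 (+ 1) 2 [] v w
    (shift posX (X+ 2 1 x y) v≡ w≡) (shift posY (Y+ 2 1 x y) v≡ w≡) λ u ())
  step⇒sees (⟨0,1⟩ {x} {y}) v w v≡ w≡ = inj₂ (VL.sees-along 4 (+ 2) 3 [] v w
    (shift posY (Y+ 0 1 x y) v≡ w≡) (shift posX (X+ 0 1 x y) v≡ w≡) λ u ())
  step⇒sees (⟨-1,1⟩ {x} {y}) v w v≡ w≡ = inj₂ (VL.sees-along 6 (ℤ.- + 3) 0 [] v w
    (shift posY (Y- 1 x y) v≡ w≡) (shift posX (X- 1 x y) v≡ w≡) λ u ())
  step⇒sees (⟨-1,2⟩ {x} {y}) v w v≡ w≡ = inj₂ (VL.sees-along 11 (ℤ.- + 1) 1 [] v w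
    (shift posY (Y- 2 x y) v≡ w≡) (shift posX (X- 2 x y) v≡ w≡) λ u ())
  step⇒sees (⟨3,1⟩ˡ {x} {y} absent) v w v≡ w≡ = inj₁ (HL.sees-along 16 (ℤ.- + 1) 0 [ + 5 , ℤ.- + 2 ] v w
    (shift posX (X+ 3 1 x y) v≡ w≡) (shift posY (Y+ 3 1 x y) v≡ w≡)
    (right-blocked (X+ 1 0 x y) (Y+ 1 0 x y) absent v v≡))
  step⇒sees (⟨3,1⟩ʳ {x} {y} absent) v w v≡ w≡ = inj₁ (HL.sees-along 16 (ℤ.- + 1) 2 [ + 12 , + 1 ] v w
    (shift posX (X+ 3 1 x y) v≡ w≡) (shift posY (Y+ 3 1 x y) v≡ w≡)
    (right-blocked (X+ 2 1 x y) (Y+ 2 1 x y) absent v v≡))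
  step⇒sees (⟨-1,3⟩ˡ {x} {y} absent) v w v≡ w≡ = inj₂ (VL.sees-along 16 (+ 1) 3 [ + 5 , + 2 ] v w
    (shift posY (Y- 3 x y) v≡ w≡) (shift posX (X- 3 x y) v≡ w≡)
    (up-blocked (Y+ 0 1 (1 + x) y) (X+ 0 1 (1 + x) y) absent v v≡))
  step⇒sees (⟨-1,3⟩ʳ {x} {y} absent) v w v≡ w≡ = inj₂ (VL.sees-along 16 (+ 1) 1 [ + 12 , ℤ.- + 1 ] v w
    (shift posY (Y- 3 x y) v≡ w≡) (shift posX (X- 3 x y) v≡ w≡)
    (up-blocked (Y- 2 x y) (X- 2 x y) absent v v≡))

  -- Adjacency is visibility itself, so the representation is exact and only a lower bound on the
  -- number of edges remains to be proved.
  graph : SimpleGraph n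
  graph = record
    { Adj        = λ v w → v ≢ w × (H.Sees v w ⊎ V.Sees v w)
    ; adj?       = λ v w → ¬? (v Fin.≟ w) ×-dec (H.sees? v w ⊎-dec V.sees? v w)
    ; Adj-sym    = λ (v≢w , s) → v≢w ∘ sym , Sum.map H.sees-sym V.sees-sym s
    ; Adj-irrefl = λ v≡w (v≢w , _) → v≢w v≡w
    }

  interiorsDisjoint : ∀ v w → v ≢ w → InteriorsDisjoint (H.placed v) (H.placed w)
  interiorsDisjoint v w v≢w x y (iv , iw) =
    let (lxv , uxv) , (lyv , uyv) = H.interior⁻¹ v {x} {y} iv
        (lxw , uxw) , (lyw , uyw) = H.interior⁻¹ w {x} {y} iw
        eqX , eqY = HL.separated (toWitness {a? = sparse? (ℤ.- + 2)} _) v w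
          (¼-cancel-< (lower<upper x lxv uxw)) (¼-cancel-< (lower<upper x lxw uxv))
          (¼-cancel-< (lower<upper y lyv uyw)) (¼-cancel-< (lower<upper y lyw uyv))
    in v≢w (cell-injective (pos-injective eqX eqY))

  graph-isURVG : IsURVG graph
  graph-isURVG = record
    { squares  = H.placed
    ; disjoint = interiorsDisjoint
    ; adj⇔band = λ v w v≢w → mk⇔
        (λ (_ , s) → Sum.map (Equivalence.to (H.sees⇔band v w)) (Equivalence.to (V.sees⇔band v w)) s)
        (λ b → v≢w , Sum.map (Equivalence.from (H.sees⇔band v w)) (Equivalence.from (V.sees⇔band v w)) b)
    }

  linked⇒adj : ∀ v w → v ≢ w → Linked Absent (cell v) (cell w) → SimpleGraph.Adj graph v w
  linked⇒adj v w v≢w (inj₁ s) = v≢w , step⇒sees s v w refl refl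
  linked⇒adj v w v≢w (inj₂ s) = v≢w , Sum.map H.sees-sym V.sees-sym (step⇒sees s w v refl refl)

-- Counting edges by sets of linked pairs of cells.

lookup-injective : ∀ {A : Set} {xs : List A} → Unique xs → ∀ {v w} → lookup xs v ≡ lookup xs w → v ≡ w
lookup-injective (_ ∷ _)  {zero}  {zero}  _  = refl
lookup-injective {xs = x ∷ xs} (x∉ ∷ _) {zero} {suc w} eq = contradiction eq (All.lookup x∉ (∈-lookup {xs = xs} w))
lookup-injective {xs = x ∷ xs} (x∉ ∷ _) {suc v} {zero} eq = contradiction (sym eq) (All.lookup x∉ (∈-lookup {xs = xs} v))
lookup-injective (_ ∷ xs!) {suc v} {suc w} eq = cong suc (lookup-injective xs! eq)

-- The partner of the first element is removed from `ys`. No later element can share it, so the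
-- others still find their partners in what remains.
matching-≤ : ∀ {A B : Set} (_∼_ : A → B → Set) {xs : List A} {ys : List B} →
  All (λ x → ∃[ y ] y ∈ ys × x ∼ y) xs → AllPairs (λ x x′ → ∀ {y} → x ∼ y → ¬ x′ ∼ y) xs → length xs ≤ length ys
matching-≤ _∼_ [] [] = ℕ.z≤n
matching-≤ {A} {B} _∼_ {x ∷ xs} {ys} ((y , y∈ys , x∼y) ∷ matched) (apart ∷ pairs) with ∈-∃++ y∈ys
... | as , bs , refl = subst (suc (length xs) ≤_) length-eq (ℕ.s≤s (matching-≤ _∼_ (tabulate rematch) pairs))
  where
  length-eq : suc (length (as ++ bs)) ≡ length (as ++ [ y ] ++ bs)
  length-eq = trans (cong suc (length-++ as)) (sym (trans (length-++ as) (ℕ.+-suc (length as) (length bs))))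
  rematch : ∀ {x′} → x′ ∈ xs → ∃[ y′ ] y′ ∈ as ++ bs × x′ ∼ y′
  rematch x′∈xs with All.lookup matched x′∈xs
  ... | y′ , y′∈ys , x′∼y′ with ∈-++⁻ as y′∈ys
  ... | inj₁ y′∈as          = y′ , ∈-++⁺ˡ y′∈as , x′∼y′
  ... | inj₂ (there y′∈bs)  = y′ , ∈-++⁺ʳ as y′∈bs , x′∼y′
  ... | inj₂ (here refl)    = contradiction x′∼y′ (All.lookup apart x′∈xs x∼y)

Distinct : Cell × Cell → Cell × Cell → Set
Distinct e f = e ≢ f × e ≢ swap f

-- A certificate for a lower bound that can grow one cell at a time. The relation is a parameter
-- independent of `cells`, so listed pairs stay valid when cells are added.
record EdgeSet (_~_ : Cell → Cell → Set) (cells : List Cell) (size : ℕ) : Set where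
  field
    cells-unique : Unique cells
    pairs        : List (Cell × Cell)
    pairs-size   : length pairs ≡ size
    related      : All (λ (c , d) → (c ∈ cells × d ∈ cells) × c ≢ d × c ~ d) pairs
    distinct     : AllPairs Distinct pairs

AbsentFrom : List Cell → Cell → Set
AbsentFrom cells c = ∀ u → lookup cells u ≢ c

LinkedIn : List Cell → Cell → Cell → Set
LinkedIn cells = Linked (AbsentFrom cells)

module _ {cells : List Cell} (G : SimpleGraph (length cells)) where

  open SimpleGraph G using (Adj; adj?; Adj-sym)

  private
    _∼_ : Cell × Cell → Fin (length cells) × Fin (length cells) → Set
    -- Both orders are allowed, since `edges` lists only the increasing one.
    (c , d) ∼ (v , w) = (lookup cells v ≡ c × lookup cells w ≡ d) ⊎ (lookup cells v ≡ d × lookup cells w ≡ c)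

    apart : ∀ {e f} → Distinct e f → ∀ {p} → e ∼ p → ¬ f ∼ p
    apart (e≢f , e≢f′) (inj₁ (refl , refl)) (inj₁ (refl , refl)) = e≢f refl
    apart (e≢f , e≢f′) (inj₁ (refl , refl)) (inj₂ (refl , refl)) = e≢f′ refl
    apart (e≢f , e≢f′) (inj₂ (refl , refl)) (inj₁ (refl , refl)) = e≢f′ refl
    apart (e≢f , e≢f′) (inj₂ (refl , refl)) (inj₂ (refl , refl)) = e≢f refl

    edge : ∀ {v w} → v Fin.< w → Adj v w → (v , w) ∈ edges G
    edge v<w adj = ∈-filter⁺ (λ (v , w) → (v Fin.<? w) ×-dec adj? v w)
      (∈-cartesianProduct⁺ (∈-allFin _) (∈-allFin _)) (v<w , adj)

  edgeSet-≤ : ∀ {_~_ size} → EdgeSet _~_ cells size →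
    (∀ v w → v ≢ w → lookup cells v ~ lookup cells w → Adj v w) → size ≤ ∣E G ∣
  edgeSet-≤ {_~_} es ~⇒Adj = subst (_≤ ∣E G ∣) pairs-size
    (matching-≤ _∼_ (tabulate realised) (AllPairs.map apart distinct))
    where
    open EdgeSet es
    realised : ∀ {e} → e ∈ pairs → ∃[ p ] p ∈ edges G × e ∼ p
    realised {c , d} e∈ with All.lookup related e∈
    ... | (c∈ , d∈) , c≢d , c~d = orient (Fin.<-cmp v w)
      where
      v = index c∈
      w = index d∈
      eqc = lookup-index c∈
      eqd = lookup-index d∈
      v≢w : v ≢ w
      v≢w v≡w = c≢d (trans eqc (trans (cong (lookup cells) v≡w) (sym eqd)))
      adj : Adj v w
      adj = ~⇒Adj v w v≢w (subst₂ _~_ eqc eqd c~d)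
      orient : Tri (v Fin.< w) (v ≡ w) (w Fin.< v) → ∃[ p ] p ∈ edges G × (c , d) ∼ p
      orient (tri< v<w _ _) = (v , w) , edge v<w adj , inj₁ (sym eqc , sym eqd)
      orient (tri≈ _ v≡w _) = contradiction v≡w v≢w
      orient (tri> _ _ w<v) = (w , v) , edge w<v (Adj-sym adj) , inj₂ (sym eqd , sym eqc)

edgeSet⇒URVG : ∀ {cells size} → EdgeSet (LinkedIn cells) cells size →
  Σ[ G ∈ SimpleGraph (length cells) ] (IsURVG G × size ≤ ∣E G ∣)
edgeSet⇒URVG {cells} es = graph , graph-isURVG , edgeSet-≤ graph es linked⇒adj
  where
  open Arrangement (lookup cells) (lookup-injective (EdgeSet.cells-unique es))

module _ {_~_ : Cell → Cell → Set} where

  -- Every new pair contains `c` and no old pair does; the new pairs differ from one another because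
  -- `N` has no repetitions.
  add-cell : ∀ {cells size c N} → EdgeSet _~_ cells size → c ∉ cells →
    Unique N → All (_∈ cells) N → All (c ~_) N → EdgeSet _~_ (c ∷ cells) (length N + size)
  add-cell {cells} {size} {c} {N} es c∉ N! N⊆ c~N = record
    { cells-unique = All.tabulate (λ d∈ c≡d → c∉ (subst (_∈ cells) (sym c≡d) d∈)) ∷ cells-unique
    ; pairs        = map (c ,_) N ++ pairs
    ; pairs-size   = trans (length-++ (map (c ,_) N)) (cong₂ _+_ (length-map (c ,_) N) pairs-size)
    ; related      = All.++⁺ (All.map⁺ (All.zipWith (λ (d∈ , c~d) → (here refl , there d∈) , (λ { refl → c∉ d∈ }) , c~d) (N⊆ , c~N)))
                             (All.map (λ ((a∈ , b∈) , rest) → (there a∈ , there b∈) , rest) related)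
    ; distinct     = AllPairs.++⁺ (AllPairs.map⁺ (star N! N⊆)) distinct
                       (All.map⁺ (All.tabulate (λ {d} _ → All.map (λ ((a∈ , b∈) , _) → fresh d a∈ b∈) related)))
    }
    where
    open EdgeSet es
    star : ∀ {N} → Unique N → All (_∈ cells) N → AllPairs (λ d d′ → Distinct (c , d) (c , d′)) N
    star [] [] = []
    star (d∉ ∷ N!) (d∈ ∷ N⊆) = All.map (λ d≢ → (λ { refl → d≢ refl }) , (λ { refl → c∉ d∈ })) d∉ ∷ star N! N⊆
    fresh : ∀ d {a b} → a ∈ cells → b ∈ cells → Distinct (c , d) (a , b)
    fresh d a∈ b∈ = (λ { refl → c∉ a∈ }) , (λ { refl → c∉ b∈ })

-- The edges within a square grid.

-- The pairs at difference (bx - ax , by - ay) in a box.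
record Block : Set where
  constructor block
  field
    ax ay bx by width height : ℕ

  place : ℕ × ℕ → Cell × Cell
  place (i , j) = (ax + i , ay + j) , (bx + i , by + j)

  blockPairs : List (Cell × Cell)
  blockPairs = map place (cartesianProduct (upTo width) (upTo height))

  -- Raising the first entry by one avoids truncation at the difference -1.
  slope : ℕ × ℕ
  slope = suc bx ∸ ax , by ∸ ay

open Block using (place; blockPairs; slope)

slopeOf : Cell × Cell → ℕ × ℕ
slopeOf ((x , y) , (x′ , y′)) = suc x′ ∸ x , y′ ∸ y

-- A linear form that is positive on all six differences used in the grid, including (-1, 1) and
-- (-1, 2). Pairs along which it increases are never reversals of each other.
rank : Cell → ℕ
rank (x , y) = x + 2 * y

Rising : Cell × Cell → Set
Rising (c , d) = rank c ℕ.< rank d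

rising⇒distinct : ∀ {ps} → Unique ps → All Rising ps → AllPairs Distinct ps
rising⇒distinct [] [] = []
rising⇒distinct (p∉ ∷ ps!) (p↑ ∷ ps↑) =
  All.zipWith (λ (p≢ , q↑) → p≢ , λ { refl → ℕ.<-asym p↑ q↑ }) (p∉ , ps↑) ∷ rising⇒distinct ps! ps↑

-- Lists with different keys are disjoint; the key of a block will be its slope.
concatMap-unique : ∀ {A B K : Set} (f : A → List B) (key : A → K) (keyOf : B → K) →
  (∀ a → Unique (f a)) → (∀ a {b} → b ∈ f a → keyOf b ≡ key a) →
  ∀ {as} → AllPairs (λ a a′ → key a ≢ key a′) as → Unique (concatMap f as)
concatMap-unique f key keyOf f! keyed {[]} [] = []
concatMap-unique f key keyOf f! keyed {a ∷ as} (a∉ ∷ as!) =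
  Unique.++⁺ (f! a) (concatMap-unique f key keyOf f! keyed as!) λ (b∈ , b∈′) →
    let a′ , a′∈ , b∈fa′ = find (∈-concatMap⁻ f {xs = as} b∈′)
    in All.lookup a∉ a′∈ (trans (sym (keyed a b∈)) (keyed a′ b∈fa′))

length-cartesianProduct : ∀ {A B : Set} (xs : List A) (ys : List B) →
  length (cartesianProduct xs ys) ≡ length xs * length ys
length-cartesianProduct [] ys = refl
length-cartesianProduct (x ∷ xs) ys = trans (length-++ (map (x ,_) ys))
  (cong₂ _+_ (length-map (x ,_) ys) (length-cartesianProduct xs ys))

length-blockPairs : ∀ b → length (blockPairs b) ≡ Block.width b * Block.height b
length-blockPairs b@(block _ _ _ _ w h) = trans (length-map (place b) (cartesianProduct (upTo w) (upTo h)))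
  (trans (length-cartesianProduct (upTo w) (upTo h)) (cong₂ _*_ (length-upTo w) (length-upTo h)))

blockPairs-unique : ∀ b → Unique (blockPairs b)
blockPairs-unique b@(block ax ay _ _ w h) =
  Unique.map⁺ (λ {p} {q} eq → cong₂ _,_ (ℕ.+-cancelˡ-≡ ax _ _ (cong (proj₁ ∘ proj₁) eq)) (ℕ.+-cancelˡ-≡ ay _ _ (cong (proj₂ ∘ proj₁) eq)))
    (Unique.cartesianProduct⁺ (Unique.upTo⁺ w) (Unique.upTo⁺ h))

∈-blockPairs⁻ : ∀ b {e} → e ∈ blockPairs b → ∃[ i ] ∃[ j ] i ℕ.< Block.width b × j ℕ.< Block.height b × e ≡ place b (i , j)
∈-blockPairs⁻ b@(block _ _ _ _ w h) e∈ with ∈-map⁻ (place b) e∈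
... | (i , j) , ij∈ , eq with ∈-cartesianProduct⁻ (upTo w) (upTo h) ij∈
... | i∈ , j∈ = i , j , ∈-upTo⁻ i∈ , ∈-upTo⁻ j∈ , eq

blockPairs-slope : ∀ b {e} → e ∈ blockPairs b → slopeOf e ≡ slope b
blockPairs-slope b e∈ with ∈-blockPairs⁻ b e∈
... | i , j , _ , _ , refl = cong₂ _,_ (cancel (suc (Block.bx b)) (Block.ax b) i) (cancel (Block.by b) (Block.ay b) j)
  where
  cancel : ∀ m n o → (m + o) ∸ (n + o) ≡ m ∸ n
  cancel m n o = trans (cong₂ _∸_ (ℕ.+-comm m o) (ℕ.+-comm n o)) (ℕ.[m+n]∸[m+o]≡n∸o o m n)

-- Coordinates start at 1, which leaves 0 free for the strips on the west and south sides.
grid : ℕ → List Cell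
grid k = cartesianProduct (applyUpTo suc k) (applyUpTo suc k)

∈-grid : ∀ {k i j} → i ℕ.< k → j ℕ.< k → (suc i , suc j) ∈ grid k
∈-grid i<k j<k = ∈-cartesianProduct⁺ (∈-applyUpTo⁺ suc i<k) (∈-applyUpTo⁺ suc j<k)

∈-grid⁻ : ∀ {k c} → c ∈ grid k → ∃[ i ] ∃[ j ] i ℕ.< k × j ℕ.< k × c ≡ (suc i , suc j)
∈-grid⁻ {k} c∈ with ∈-cartesianProduct⁻ (applyUpTo suc k) (applyUpTo suc k) c∈
... | x∈ , y∈ with ∈-applyUpTo⁻ suc x∈ | ∈-applyUpTo⁻ suc y∈
... | i , i<k , refl | j , j<k , refl = i , j , i<k , j<k , refl

grid-unique : ∀ k → Unique (grid k)
grid-unique k = Unique.cartesianProduct⁺ axis axis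
  where
  axis = Unique.applyUpTo⁺₁ suc k (λ i<j _ eq → ℕ.<⇒≢ i<j (ℕ.suc-injective eq))

length-grid : ∀ k → length (grid k) ≡ k * k
length-grid k = trans (length-cartesianProduct (applyUpTo suc k) (applyUpTo suc k))
  (cong₂ _*_ (length-applyUpTo suc k) (length-applyUpTo suc k))

-- In a grid of side k = 2 + m the difference (a, b) occurs (k - |a|)(k - |b|) times. The first
-- three blocks contribute k(k - 1) + (k - 1)² + (k - 2)(k - 1) = 3(k - 1)² pairs, and so do the
-- last three.
gridBlocks : ℕ → List Block
gridBlocks m =
    block 1 1 2 1 (1 + m) (2 + m)
  ∷ block 1 1 2 2 (1 + m) (1 + m)
  ∷ block 1 1 3 2 m (1 + m)
  ∷ block 1 1 1 2 (2 + m) (1 + m)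
  ∷ block 2 1 1 2 (1 + m) (1 + m)
  ∷ block 2 1 1 3 (1 + m) m
  ∷ []

grid-edgeSet : ∀ Absent m → EdgeSet (Linked Absent) (grid (2 + m)) (6 * ((1 + m) * (1 + m)))
grid-edgeSet Absent m = record
  { cells-unique = grid-unique (2 + m)
  ; pairs        = gridPairs
  ; pairs-size   = size
  ; related      = tabulate λ e∈ → let within , _ , s = legit e∈ in within , rising⇒≢ (rising e∈) , inj₁ s
  ; distinct     = rising⇒distinct
      (concatMap-unique blockPairs slope slopeOf blockPairs-unique blockPairs-slope
        -- The slopes are numerals independent of `m`, so their distinctness is a computation.
        (toWitness {a? = allPairs? (λ b b′ → ¬? (slope b ≟ᶜ slope b′)) (gridBlocks m)} _))
      (tabulate rising)
  }
  where
  gridPairs : List (Cell × Cell)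
  gridPairs = concatMap blockPairs (gridBlocks m)

  Legit : Cell × Cell → Set
  Legit (c , d) = (c ∈ grid (2 + m) × d ∈ grid (2 + m)) × Rising (c , d) × Step Absent c d

  LegitBlock : Block → Set
  LegitBlock b = ∀ {i j} → i ℕ.< Block.width b → j ℕ.< Block.height b → Legit (place b (i , j))

  climb : ∀ ax ay bx by i j → ax + 2 * ay ℕ.< bx + 2 * by → Rising ((ax + i , ay + j) , (bx + i , by + j))
  climb ax ay bx by i j lt = subst₂ ℕ._<_ (regroup ax ay i j) (regroup bx by i j) (ℕ.+-monoˡ-< (i + 2 * j) lt)
    where
    regroup : ∀ a b i j → (a + 2 * b) + (i + 2 * j) ≡ (a + i) + 2 * (b + j)
    regroup = ℕ-solve-∀

  ↑ : ∀ {i n} → i ℕ.< n → i ℕ.< suc n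
  ↑ = ℕ.m<n⇒m<1+n

  legitBlocks : All LegitBlock (gridBlocks m)
  legitBlocks =
      (λ {i} {j} i< j< → (∈-grid (↑ i<) j< , ∈-grid (ℕ.s≤s i<) j<) , climb 1 1 2 1 i j (ℕ.m<m+n 3 ℕ.z<s) , ⟨1,0⟩)
    ∷ (λ {i} {j} i< j< → (∈-grid (↑ i<) (↑ j<) , ∈-grid (ℕ.s≤s i<) (ℕ.s≤s j<)) , climb 1 1 2 2 i j (ℕ.m<m+n 3 ℕ.z<s) , ⟨1,1⟩)
    ∷ (λ {i} {j} i< j< → (∈-grid (↑ (↑ i<)) (↑ j<) , ∈-grid (ℕ.s≤s (ℕ.s≤s i<)) (ℕ.s≤s j<)) , climb 1 1 3 2 i j (ℕ.m<m+n 3 ℕ.z<s) , ⟨2,1⟩)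
    ∷ (λ {i} {j} i< j< → (∈-grid i< (↑ j<) , ∈-grid i< (ℕ.s≤s j<)) , climb 1 1 1 2 i j (ℕ.m<m+n 3 ℕ.z<s) , ⟨0,1⟩)
    ∷ (λ {i} {j} i< j< → (∈-grid (ℕ.s≤s i<) (↑ j<) , ∈-grid (↑ i<) (ℕ.s≤s j<)) , climb 2 1 1 2 i j (ℕ.m<m+n 4 ℕ.z<s) , ⟨-1,1⟩)
    ∷ (λ {i} {j} i< j< → (∈-grid (ℕ.s≤s i<) (↑ (↑ j<)) , ∈-grid (↑ i<) (ℕ.s≤s (ℕ.s≤s j<))) , climb 2 1 1 3 i j (ℕ.m<m+n 4 ℕ.z<s) , ⟨-1,2⟩)
    ∷ []

  legit : ∀ {e} → e ∈ gridPairs → Legit e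
  legit e∈ with find (∈-concatMap⁻ blockPairs {xs = gridBlocks m} e∈)
  ... | b , b∈ , e∈b with ∈-blockPairs⁻ b e∈b
  ... | i , j , i< , j< , refl = All.lookup legitBlocks b∈ i< j<

  rising : ∀ {e} → e ∈ gridPairs → Rising e
  rising e∈ = proj₁ (proj₂ (legit e∈))

  rising⇒≢ : ∀ {c d} → Rising (c , d) → c ≢ d
  rising⇒≢ lt refl = ℕ.<-irrefl refl lt

  length-concatMap : ∀ bs → length (concatMap blockPairs bs) ≡ sum (map (λ b → Block.width b * Block.height b) bs)
  length-concatMap [] = refl
  length-concatMap (b ∷ bs) = trans (length-++ (blockPairs b)) (cong₂ _+_ (length-blockPairs b) (length-concatMap bs))

  size : length gridPairs ≡ 6 * ((1 + m) * (1 + m))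
  size = trans (length-concatMap (gridBlocks m)) (ring m)
    where
    ring : ∀ m → (1 + m) * (2 + m) + ((1 + m) * (1 + m) + (m * (1 + m) + ((2 + m) * (1 + m) +
      ((1 + m) * (1 + m) + ((1 + m) * m + 0))))) ≡ 6 * ((1 + m) * (1 + m))
    ring = ℕ-solve-∀

-- Strips along the four sides of the grid.

data Side : Set where
  north west south east : Side

-- The square [1 , 5 + b]², with a strip of at most 1 + b cells along each of
-- its sides.  The strips are images of each other under quarter turns.
module Strips (b : ℕ) where

  line : Side → ℕ → Cell
  line north p = 4 + p , 6 + b
  line west  p = 0 , 4 + p
  line south p = 2 + p , 0
  line east  p = 6 + b , 2 + p

  -- Each strip is filled away from its blocker, which lies before the low end of the line for
  -- `north` and `west` and beyond the high end for `south` and `east`.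
  offset : Side → ℕ → ℕ
  offset north o = o
  offset west  o = o
  offset south o = b ∸ o
  offset east  o = b ∸ o

  strip : Side → ℕ → Cell
  strip s o = line s (offset s o)

  offset-≤ : ∀ s {o} → o ≤ b → offset s o ≤ b
  offset-≤ north o≤b = o≤b
  offset-≤ west  o≤b = o≤b
  offset-≤ south {o} _ = ℕ.m∸n≤m b o
  offset-≤ east  {o} _ = ℕ.m∸n≤m b o

  strip-injective : ∀ s {o o′} → o ≤ b → o′ ≤ b → strip s o ≡ strip s o′ → o ≡ o′
  strip-injective north _ _ refl = refl
  strip-injective west  _ _ refl = refl
  strip-injective south o≤ o′≤ eq = ℕ.∸-cancelˡ-≡ o≤ o′≤ (ℕ.+-cancelˡ-≡ 2 _ _ (cong proj₁ eq))
  strip-injective east  o≤ o′≤ eq = ℕ.∸-cancelˡ-≡ o≤ o′≤ (ℕ.+-cancelˡ-≡ 2 _ _ (cong proj₂ eq))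

  -- The open half-plane on the inner side of a strip. It contains the grid and the other three
  -- strips, so a new cell on the line is distinct from all of them.
  Off : Side → Cell → Set
  Off north (x , y) = y ℕ.< 6 + b
  Off west  (x , y) = 0 ℕ.< x
  Off south (x , y) = 0 ℕ.< y
  Off east  (x , y) = x ℕ.< 6 + b

  line-on : ∀ s p → ¬ Off s (line s p)
  line-on north p = ℕ.<-irrefl refl
  line-on west  p = ℕ.<-irrefl refl
  line-on south p = ℕ.<-irrefl refl
  line-on east  p = ℕ.<-irrefl refl

  private
    2+<6+ : ∀ {p} → p ≤ b → 2 + p ℕ.< 6 + b
    2+<6+ p≤b = ℕ.+-mono-≤ {3} {6} (ℕ.m≤m+n 3 3) p≤b

    4+<6+ : ∀ {p} → p ≤ b → 4 + p ℕ.< 6 + b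
    4+<6+ p≤b = ℕ.+-mono-≤ {5} {6} (ℕ.m≤m+n 5 1) p≤b

  line-off : ∀ s t {p} → s ≢ t → p ≤ b → Off s (line t p)
  line-off north north s≢t _  = contradiction refl s≢t
  line-off north west  _ p≤b  = 4+<6+ p≤b
  line-off north south _ _    = ℕ.z<s
  line-off north east  _ p≤b  = 2+<6+ p≤b
  line-off west  north _ _    = ℕ.z<s
  line-off west  west  s≢t _  = contradiction refl s≢t
  line-off west  south _ _    = ℕ.z<s
  line-off west  east  _ _    = ℕ.z<s
  line-off south north _ _    = ℕ.z<s
  line-off south west  _ _    = ℕ.z<s
  line-off south south s≢t _  = contradiction refl s≢t
  line-off south east  _ _    = ℕ.z<s
  line-off east  north _ p≤b  = 4+<6+ p≤b
  line-off east  west  _ _    = ℕ.z<s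
  line-off east  south _ p≤b  = 2+<6+ p≤b
  line-off east  east  s≢t _  = contradiction refl s≢t

  ∈-core : ∀ {i j} → i ℕ.< 5 + b → j ℕ.< 5 + b → (suc i , suc j) ∈ grid (5 + b)
  ∈-core = ∈-grid {5 + b}

  grid-off : ∀ s {c} → c ∈ grid (5 + b) → Off s c
  grid-off s c∈ with s | ∈-grid⁻ {5 + b} c∈
  ... | north | _ , _ , _ , j< , refl = ℕ.s≤s j<
  ... | west  | _ , _ , _ , _ , refl = ℕ.z<s
  ... | south | _ , _ , _ , _ , refl = ℕ.z<s
  ... | east  | _ , _ , i< , _ , refl = ℕ.s≤s i<

  blocker : Side → Cell
  blocker north = 3 , 6 + b
  blocker west  = 0 , 3
  blocker south = 3 + b , 0
  blocker east  = 6 + b , 3 + b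

  blocker-on : ∀ s → ¬ Off s (blocker s)
  blocker-on north = ℕ.<-irrefl refl
  blocker-on west  = ℕ.<-irrefl refl
  blocker-on south = ℕ.<-irrefl refl
  blocker-on east  = ℕ.<-irrefl refl

  line≢blocker : ∀ s t {p} → p ≤ b → line t p ≢ blocker s
  line≢blocker north north _ ()
  line≢blocker north west  _ ()
  line≢blocker north south _ ()
  line≢blocker north east  _ ()
  line≢blocker west  north _ ()
  line≢blocker west  west  _ ()
  line≢blocker west  south _ ()
  line≢blocker west  east  _ ()
  line≢blocker south north _ ()
  line≢blocker south west  _ ()
  line≢blocker south south p≤b refl = ℕ.<-irrefl refl p≤b
  line≢blocker south east  _ ()
  line≢blocker east  north _ ()
  line≢blocker east  west  _ ()
  line≢blocker east  south _ ()
  line≢blocker east  east  p≤b refl = ℕ.<-irrefl refl p≤b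

  -- `applyDownFrom` lists the latest cell of a strip first, matching the `c ∷ cells` of `add-cell`.
  layers : List (Side × ℕ) → List Cell
  layers []             = grid (5 + b)
  layers ((s , m) ∷ ss) = applyDownFrom (strip s) m ++ layers ss

  Short : Side × ℕ → Set
  Short (_ , m) = m ≤ 1 + b

  layers-elim : ∀ (P : Cell → Set) {ss} → (∀ {c} → c ∈ grid (5 + b) → P c) →
    All (λ (t , _) → ∀ {p} → p ≤ b → P (line t p)) ss → All Short ss → ∀ {c} → c ∈ layers ss → P c
  layers-elim P {[]} in-grid [] [] c∈ = in-grid c∈
  layers-elim P {(t , m) ∷ ss} in-grid (in-line ∷ in-lines) (m≤ ∷ short) c∈ with ∈-++⁻ (applyDownFrom (strip t) m) c∈
  ... | inj₂ c∈′ = layers-elim P in-grid in-lines short c∈′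
  ... | inj₁ c∈′ with ∈-applyDownFrom⁻ (strip t) c∈′
  ... | o , o<m , refl = in-line (offset-≤ t (ℕ.≤-pred (ℕ.≤-trans o<m m≤)))

  grid⊆layers : ∀ ss {c} → c ∈ grid (5 + b) → c ∈ layers ss
  grid⊆layers []             c∈ = c∈
  grid⊆layers ((s , m) ∷ ss) c∈ = ∈-++⁺ʳ (applyDownFrom (strip s) m) (grid⊆layers ss c∈)

  blocker-absent : ∀ {ss} → All Short ss → ∀ s → AbsentFrom (layers ss) (blocker s)
  blocker-absent {ss} short s u eq = layers-elim (_≢ blocker s) {ss}
    (λ { c∈ refl → blocker-on s (grid-off s c∈) })
    (tabulate λ {(t , _)} _ → line≢blocker s t) short (∈-lookup {xs = layers ss} u) eq

  -- The grid cells at five of the six step differences; the sixth direction runs along the strip.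
  inner : Side → ℕ → List Cell
  inner north p = (4 + p , 5 + b) ∷ (3 + p , 5 + b) ∷ (2 + p , 5 + b) ∷ (5 + p , 5 + b) ∷ (5 + p , 4 + b) ∷ []
  inner west  p = (1 , 4 + p) ∷ (1 , 3 + p) ∷ (1 , 2 + p) ∷ (1 , 5 + p) ∷ (2 , 5 + p) ∷ []
  inner south p = (2 + p , 1) ∷ (3 + p , 1) ∷ (4 + p , 1) ∷ (1 + p , 1) ∷ (1 + p , 2) ∷ []
  inner east  p = (5 + b , 2 + p) ∷ (5 + b , 3 + p) ∷ (5 + b , 4 + p) ∷ (5 + b , 1 + p) ∷ (4 + b , 1 + p) ∷ []

  inner⊆grid : ∀ s {p} → p ≤ b → All (_∈ grid (5 + b)) (inner s p)
  inner⊆grid s {p} p≤b = go s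
    where
    p+ : ∀ i {_ : True (i ℕ.<? 5)} → i + p ℕ.< 5 + b
    p+ i {i<5} = ℕ.+-mono-≤ (toWitness i<5) p≤b
    b+ : ∀ i {_ : True (i ℕ.<? 5)} → i + b ℕ.< 5 + b
    b+ i {i<5} = ℕ.+-monoˡ-< b (toWitness i<5)
    go : ∀ s → All (_∈ grid (5 + b)) (inner s p)
    go north = ∈-core (p+ 3) (b+ 4) ∷ ∈-core (p+ 2) (b+ 4) ∷ ∈-core (p+ 1) (b+ 4) ∷ ∈-core (p+ 4) (b+ 4) ∷ ∈-core (p+ 4) (b+ 3) ∷ []
    go west  = ∈-core ℕ.z<s (p+ 3) ∷ ∈-core ℕ.z<s (p+ 2) ∷ ∈-core ℕ.z<s (p+ 1) ∷ ∈-core ℕ.z<s (p+ 4) ∷ ∈-core (ℕ.s<s ℕ.z<s) (p+ 4) ∷ []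
    go south = ∈-core (p+ 1) ℕ.z<s ∷ ∈-core (p+ 2) ℕ.z<s ∷ ∈-core (p+ 3) ℕ.z<s ∷ ∈-core (p+ 0) ℕ.z<s ∷ ∈-core (p+ 0) (ℕ.s<s ℕ.z<s) ∷ []
    go east  = ∈-core (b+ 4) (p+ 1) ∷ ∈-core (b+ 4) (p+ 2) ∷ ∈-core (b+ 4) (p+ 3) ∷ ∈-core (b+ 4) (p+ 0) ∷ ∈-core (b+ 3) (p+ 0) ∷ []

  inner-unique : ∀ s p → Unique (inner s p)
  inner-unique north p =
    ((λ ()) ∷ (λ ()) ∷ (λ ()) ∷ (λ ()) ∷ []) ∷ ((λ ()) ∷ (λ ()) ∷ (λ ()) ∷ []) ∷
    ((λ ()) ∷ (λ ()) ∷ []) ∷ ((λ ()) ∷ []) ∷ [] ∷ []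
  inner-unique west  p =
    ((λ ()) ∷ (λ ()) ∷ (λ ()) ∷ (λ ()) ∷ []) ∷ ((λ ()) ∷ (λ ()) ∷ (λ ()) ∷ []) ∷
    ((λ ()) ∷ (λ ()) ∷ []) ∷ ((λ ()) ∷ []) ∷ [] ∷ []
  inner-unique south p =
    ((λ ()) ∷ (λ ()) ∷ (λ ()) ∷ (λ ()) ∷ []) ∷ ((λ ()) ∷ (λ ()) ∷ (λ ()) ∷ []) ∷
    ((λ ()) ∷ (λ ()) ∷ []) ∷ ((λ ()) ∷ []) ∷ [] ∷ []
  inner-unique east  p =
    ((λ ()) ∷ (λ ()) ∷ (λ ()) ∷ (λ ()) ∷ []) ∷ ((λ ()) ∷ (λ ()) ∷ (λ ()) ∷ []) ∷
    ((λ ()) ∷ (λ ()) ∷ []) ∷ ((λ ()) ∷ []) ∷ [] ∷ []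

  distant : Side → Cell
  distant north = 1 , 5 + b
  distant west  = 1 , 1
  distant south = 5 + b , 1
  distant east  = 5 + b , 5 + b

  distant∈grid : ∀ s → distant s ∈ grid (5 + b)
  distant∈grid north = ∈-core ℕ.z<s (ℕ.n<1+n (4 + b))
  distant∈grid west  = ∈-core ℕ.z<s ℕ.z<s
  distant∈grid south = ∈-core (ℕ.n<1+n (4 + b)) ℕ.z<s
  distant∈grid east  = ∈-core (ℕ.n<1+n (4 + b)) (ℕ.n<1+n (4 + b))

  distant∉inner : ∀ s → All (distant s ≢_) (inner s (offset s 0))
  distant∉inner north = (λ ()) ∷ (λ ()) ∷ (λ ()) ∷ (λ ()) ∷ (λ ()) ∷ []
  distant∉inner west  = (λ ()) ∷ (λ ()) ∷ (λ ()) ∷ (λ ()) ∷ (λ ()) ∷ []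
  distant∉inner south = (λ ()) ∷ (λ ()) ∷ (λ ()) ∷ (λ ()) ∷ (λ ()) ∷ []
  distant∉inner east  = (λ ()) ∷ (λ ()) ∷ (λ ()) ∷ (λ ()) ∷ (λ ()) ∷ []

  neighbours : Side → ℕ → List Cell
  neighbours s zero    = distant s ∷ inner s (offset s 0)
  neighbours s (suc o) = strip s o ∷ inner s (offset s (suc o))

  length-neighbours : ∀ s o → length (neighbours s o) ≡ 6
  length-neighbours north zero    = refl
  length-neighbours north (suc o) = refl
  length-neighbours west  zero    = refl
  length-neighbours west  (suc o) = refl
  length-neighbours south zero    = refl
  length-neighbours south (suc o) = refl
  length-neighbours east  zero    = refl
  length-neighbours east  (suc o) = refl

  neighbours-unique : ∀ s o → o ≤ b → Unique (neighbours s o)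
  neighbours-unique s zero    _   = distant∉inner s ∷ inner-unique s (offset s 0)
  neighbours-unique s (suc o) o<b =
    All.map (λ { c∈ refl → line-on s (offset s o) (grid-off s c∈) }) (inner⊆grid s (offset-≤ s o<b)) ∷
    inner-unique s (offset s (suc o))

  neighbours-present : ∀ s ss o → o ≤ b → All (_∈ layers ((s , o) ∷ ss)) (neighbours s o)
  neighbours-present s ss zero    o≤b = All.map (grid⊆layers ss) (distant∈grid s ∷ inner⊆grid s (offset-≤ s o≤b))
  neighbours-present s ss (suc o) o≤b = here refl ∷ All.map (grid⊆layers ((s , suc o) ∷ ss)) (inner⊆grid s (offset-≤ s o≤b))

  module _ {Absent : Cell → Set} where

    inner-linked : ∀ s p → All (Linked Absent (line s p)) (inner s p)
    inner-linked north p = inj₂ ⟨0,1⟩ ∷ inj₂ ⟨1,1⟩ ∷ inj₂ ⟨2,1⟩ ∷ inj₂ ⟨-1,1⟩ ∷ inj₂ ⟨-1,2⟩ ∷ []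
    inner-linked west  p = inj₁ ⟨1,0⟩ ∷ inj₂ ⟨-1,1⟩ ∷ inj₂ ⟨-1,2⟩ ∷ inj₁ ⟨1,1⟩ ∷ inj₁ ⟨2,1⟩ ∷ []
    inner-linked south p = inj₁ ⟨0,1⟩ ∷ inj₁ ⟨1,1⟩ ∷ inj₁ ⟨2,1⟩ ∷ inj₁ ⟨-1,1⟩ ∷ inj₁ ⟨-1,2⟩ ∷ []
    inner-linked east  p = inj₂ ⟨1,0⟩ ∷ inj₁ ⟨-1,1⟩ ∷ inj₁ ⟨-1,2⟩ ∷ inj₂ ⟨1,1⟩ ∷ inj₂ ⟨2,1⟩ ∷ []

    distant-linked : ∀ s → Absent (blocker s) → Linked Absent (strip s 0) (distant s)
    distant-linked north absent = inj₂ (⟨3,1⟩ʳ absent)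
    distant-linked west  absent = inj₂ (⟨-1,3⟩ʳ absent)
    distant-linked south absent = inj₁ (⟨3,1⟩ˡ absent)
    distant-linked east  absent = inj₁ (⟨-1,3⟩ˡ absent)

    strip-linked : ∀ s o → suc o ≤ b → Linked Absent (strip s (suc o)) (strip s o)
    strip-linked north o _   = inj₂ ⟨1,0⟩
    strip-linked west  o _   = inj₂ ⟨0,1⟩
    -- The rewrite turns `b ∸ o` into `suc (b ∸ suc o)`: this strip is filled downwards, so the
    -- previous cell is one step ahead of the new one.
    strip-linked south o o<b rewrite ℕ.+-∸-assoc 1 o<b = inj₁ ⟨1,0⟩
    strip-linked east  o o<b rewrite ℕ.+-∸-assoc 1 o<b = inj₁ ⟨0,1⟩

    neighbours-linked : ∀ s o → o ≤ b → Absent (blocker s) → All (Linked Absent (strip s o)) (neighbours s o)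
    neighbours-linked s zero    _   absent = distant-linked s absent ∷ inner-linked s (offset s 0)
    neighbours-linked s (suc o) o≤b _      = strip-linked s o o≤b ∷ inner-linked s (offset s (suc o))

    -- Induction on the length of the strip, six pairs per cell. `Absent` stays fixed throughout: it
    -- will mean absence from the finished arrangement, so later cells cannot spoil a line of sight.
    add-strip : (∀ s → Absent (blocker s)) → ∀ {s ss size} → All (λ (t , _) → s ≢ t) ss → All Short ss →
      EdgeSet (Linked Absent) (layers ss) size →
      ∀ m → m ≤ 1 + b → EdgeSet (Linked Absent) (layers ((s , m) ∷ ss)) (6 * m + size)
    add-strip absent s∉ short es zero _ = es
    add-strip absent {s} {ss} {size} s∉ short es (suc m) (ℕ.s≤s m≤b) =
      subst (EdgeSet (Linked Absent) _) size-eq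
        (add-cell (add-strip absent s∉ short es m (ℕ.m≤n⇒m≤1+n m≤b)) fresh
          (neighbours-unique s m m≤b) (neighbours-present s ss m m≤b) (neighbours-linked s m m≤b (absent s)))
      where
      size-eq : length (neighbours s m) + (6 * m + size) ≡ 6 * suc m + size
      size-eq = trans (cong (_+ (6 * m + size)) (length-neighbours s m))
        (trans (sym (ℕ.+-assoc 6 (6 * m) size)) (cong (_+ size) (sym (ℕ.*-suc 6 m))))
      fresh : strip s m ∉ layers ((s , m) ∷ ss)
      fresh c∈ with ∈-++⁻ (applyDownFrom (strip s) m) c∈
      ... | inj₂ c∈′ = line-on s (offset s m)
        (layers-elim (Off s) (grid-off s) (All.map (λ s≢t {p} → line-off s _ {p} s≢t) s∉) short c∈′)
      ... | inj₁ c∈′ with ∈-applyDownFrom⁻ (strip s) c∈′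
      ... | o , o<m , eq = ℕ.<⇒≢ o<m (sym (strip-injective s m≤b (ℕ.≤-trans (ℕ.<⇒≤ o<m) m≤b) eq))

  total : List (Side × ℕ) → ℕ
  total ss = sum (map proj₂ ss)

  length-layers : ∀ ss → length (layers ss) ≡ total ss + (5 + b) * (5 + b)
  length-layers []             = length-grid (5 + b)
  length-layers ((s , m) ∷ ss) = trans (length-++ (applyDownFrom (strip s) m))
    (trans (cong₂ _+_ (length-applyDownFrom (strip s) m) (length-layers ss)) (sym (ℕ.+-assoc m (total ss) _)))

  layers-edgeSet : ∀ {Absent} → (∀ s → Absent (blocker s)) → ∀ {ss} →
    AllPairs (λ (s , _) (t , _) → s ≢ t) ss → All Short ss →
    EdgeSet (Linked Absent) (layers ss) (6 * (total ss + (4 + b) * (4 + b)))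
  layers-edgeSet {Absent} absent [] [] = grid-edgeSet Absent (3 + b)
  layers-edgeSet absent {(s , m) ∷ ss} (s∉ ∷ ss!) (m≤ ∷ short) =
    subst (EdgeSet _ _) (trans (sym (ℕ.*-distribˡ-+ 6 m _)) (cong (6 *_) (sym (ℕ.+-assoc m (total ss) _))))
      (add-strip absent s∉ short (layers-edgeSet absent ss! short) m m≤)

  fill : ℕ → List Side → List (Side × ℕ)
  fill r []       = []
  fill r (s ∷ ss) = (s , (1 + b) ⊓ r) ∷ fill (r ∸ (1 + b)) ss

  fill-short : ∀ r ss → All Short (fill r ss)
  fill-short r []       = []
  fill-short r (s ∷ ss) = ℕ.m⊓n≤m (1 + b) r ∷ fill-short (r ∸ (1 + b)) ss

  total-fill : ∀ r ss → r ≤ length ss * (1 + b) → total (fill r ss) ≡ r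
  total-fill r []       r≤0 = sym (ℕ.n≤0⇒n≡0 r≤0)
  total-fill r (s ∷ ss) r≤  = trans
    (cong (λ t → (1 + b) ⊓ r + t) (total-fill (r ∸ (1 + b)) ss (ℕ.m≤n+o⇒m∸n≤o r (1 + b) r≤)))
    (ℕ.m⊓n+n∸m≡n (1 + b) r)

  extended-grid : ∀ r → r ≤ 4 * (1 + b) →
    Σ[ G ∈ SimpleGraph (r + (5 + b) * (5 + b)) ] (IsURVG G × 6 * (r + (4 + b) * (4 + b)) ≤ ∣E G ∣)
  extended-grid r r≤ = subst₂ Conclusion
    (trans (length-layers ss) (cong (_+ (5 + b) * (5 + b)) total≡r))
    (cong (λ m → 6 * (m + (4 + b) * (4 + b))) total≡r)
    -- Here `Absent` becomes absence from the final list of cells.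
    (edgeSet⇒URVG (layers-edgeSet (blocker-absent short)
      (((λ ()) ∷ (λ ()) ∷ (λ ()) ∷ []) ∷ ((λ ()) ∷ (λ ()) ∷ []) ∷ ((λ ()) ∷ []) ∷ [] ∷ []) short))
    where
    ss = fill r (north ∷ west ∷ south ∷ east ∷ [])
    short = fill-short r (north ∷ west ∷ south ∷ east ∷ [])
    total≡r = total-fill r (north ∷ west ∷ south ∷ east ∷ []) r≤
    Conclusion : ℕ → ℕ → Set₁
    Conclusion n e = Σ[ G ∈ SimpleGraph n ] (IsURVG G × e ≤ ∣E G ∣)

-- Choice of the grid and the strips for a given `n`.

theorem6p5 : ∀ (n : ℕ) → 64 ≤ n → Σ[ G ∈ SimpleGraph n ] (IsURVG G × (6 * n ∸ 12 * ⌊√ n ⌋) + 6 ≤ ∣E G ∣)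
theorem6p5 n 64≤n with ⌊√ n ⌋ | ⌊√⌋-spec n
... | k | k²≤n , n<[1+k]² = subst (λ n → Σ[ G ∈ SimpleGraph n ] (IsURVG G × (6 * n ∸ 12 * k) + 6 ≤ ∣E G ∣)) n≡
    (let G , urvg , enough = Strips.extended-grid b r r≤ in G , urvg , subst (_≤ ∣E G ∣) count enough)
  where
  -- The grid has side `5 + b`, which is `k`, and the remaining `r` cells go into the strips.
  b = k ∸ 5
  r = n ∸ k * k

  8≤k : 8 ≤ k
  -- For `k < 8` the square of `1 + k` would be at most 64.
  8≤k = ℕ.≮⇒≥ λ k<8 → ℕ.<⇒≱ n<[1+k]² (ℕ.≤-trans (ℕ.*-mono-≤ k<8 k<8) 64≤n)

  k≡ : 5 + b ≡ k
  k≡ = ℕ.m+[n∸m]≡n (ℕ.≤-trans (ℕ.m≤m+n 5 3) 8≤k)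

  n≡ : r + (5 + b) * (5 + b) ≡ n
  n≡ = trans (cong (λ k → r + k * k) k≡) (ℕ.m∸n+n≡m k²≤n)

  r≤2k : r ≤ 2 * k
  r≤2k = ℕ.m≤n+o⇒m∸n≤o n (k * k) (ℕ.≤-pred (subst (n ℕ.<_) (binomial k) n<[1+k]²))
    where
    binomial : ∀ k → suc k * suc k ≡ suc (k * k + 2 * k)
    binomial = ℕ-solve-∀

  r≤ : r ≤ 4 * (1 + b)
  -- As `b` is at least 3, 2k = (4 + 2b) + 6 ≤ (4 + 2b) + 2b = 4(1 + b).
  r≤ = ℕ.≤-trans r≤2k (subst (_≤ 4 * (1 + b)) (cong (2 *_) k≡)
    (subst₂ _≤_ (left-side b) (right-side b) (ℕ.+-monoʳ-≤ (4 + 2 * b) (ℕ.*-monoʳ-≤ 2 3≤b))))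
    where
    3≤b : 3 ≤ b
    3≤b = ℕ.∸-monoˡ-≤ 5 8≤k
    left-side : ∀ b → 4 + 2 * b + 2 * 3 ≡ 2 * (5 + b)
    left-side = ℕ-solve-∀
    right-side : ∀ b → 4 + 2 * b + 2 * b ≡ 4 * (1 + b)
    right-side = ℕ-solve-∀

  count : 6 * (r + (4 + b) * (4 + b)) ≡ (6 * (r + (5 + b) * (5 + b)) ∸ 12 * k) + 6
  -- The minuend is rewritten as 12k plus a remainder, so the truncated subtraction is exact; the
  -- remainder plus 6 is 6(r + (k - 1)²).
  count = sym (trans (cong (λ k → (6 * (r + (5 + b) * (5 + b)) ∸ 12 * k) + 6) (sym k≡))
    (trans (cong (_+ 6) (trans (cong (_∸ 12 * (5 + b)) (expand r b)) (ℕ.m+n∸m≡n (12 * (5 + b)) _))) (collect r b)))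
    where
    expand : ∀ r b → 6 * (r + (5 + b) * (5 + b)) ≡ 12 * (5 + b) + (90 + 48 * b + 6 * (b * b) + 6 * r)
    expand = ℕ-solve-∀
    collect : ∀ r b → (90 + 48 * b + 6 * (b * b) + 6 * r) + 6 ≡ 6 * (r + (4 + b) * (4 + b))
    collect = ℕ-solve-∀
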